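{- Let $P$ be a finite naturally labeled poset whose shape $\operatorname{sh}(P)$ is hook shaped. If $Q$ is a finite naturally labeled poset with $\operatorname{supp}_L(K_P(\mathbf{x}))=\operatorname{supp}_L(K_Q(\mathbf{x}))$, then $P\cong Q$.
   Context: A poset $(P,\preceq)$ on ground set $[n]=\{1,\dots,n\}$ is naturally labeled if $x\preceq y$ implies $x\le y$ as integers. For such $P$, the $P$-partition generating function is $K_P(\mathbf{x})=\sum_{\sigma}\prod_{p\in P}x_{\sigma(p)}$, the sum over all maps $\sigma:P\to\mathbb{Z}^+$ with $\sigma(x)\le\sigma(y)$ whenever $x\preceq y$; it is a quasisymmetric function. For a composition $\alpha=(\alpha_1,\dots,\alpha_k)$ of $n$ let $D(\alpha)=\{\alpha_1,\alpha_1+\alpha_2,\dots,\alpha_1+\cdots+\alpha_{k-1}\}$, and let $L_\alpha=\sum x_{i_1}\cdots x_{i_n}$, summed over $i_1\le\cdots\le i_n$ with $i_s<i_{s+1}$ whenever $s\in D(\alpha)$. The $L_\alpha$ form a basis of quasisymmetric functions, and $\operatorname{supp}_L(K_P(\mathbf{x}))$ is the set of compositions $\alpha$ whose coefficient in the expansion of $K_P(\mathbf{x})$ in this basis is nonzero. The shape $\operatorname{sh}(P)$ is the partition $\lambda$ whose conjugate $\lambda'$ satisfies $\lambda'_1+\cdots+\lambda'_i=a_i$ for all $i$, where $a_i$ is the maximum number of elements in a union of $i$ antichains of $P$. A partition $\lambda$ is hook shaped if $\lambda_2\le 1$, i.e. $\lambda=(\lambda_1,1,\dots,1)$. -}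

module Defs where

open import Data.Bool using (Bool; true; false; T; _∧_; _∨_; not; if_then_else_)
open import Data.Nat using (ℕ; zero; suc; _+_; _∸_; _≤_; _≤ᵇ_; _≡ᵇ_; pred)
open import Data.Fin using (Fin; toℕ)
open import Data.Fin.Subset using (Subset; _∈_; _∪_; ⊥; ∣_∣)
open import Data.List using (List; []; _∷_; map; concatMap; length; filterᵇ; foldr; upTo; allFin)
open import Data.Bool.ListAction using (all; any)
import Data.List as L
open import Data.List.Membership.Propositional using () renaming (_∈_ to _∈ˡ_)
open import Data.Vec using (Vec; lookup)
import Data.Vec as V
open import Data.Integer using (ℤ; +_; 0ℤ) renaming (_+_ to _+ℤ_; _*_ to _*ℤ_)
open import Data.Product using (Σ; ∃; _×_)
open import Function.Bundles using (_↔_; Inverse)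
open import Relation.Binary.PropositionalEquality using (_≡_; _≢_)

-- Finite naturally labeled posets on [n] (element x : Fin n has label toℕ x + 1)

record NatLabeledPoset (n : ℕ) : Set where
  field
    _≼_      : Fin n → Fin n → Bool
    ≼-refl   : ∀ x → T (x ≼ x)
    ≼-antisym : ∀ x y → T (x ≼ y) → T (y ≼ x) → x ≡ y
    ≼-trans  : ∀ x y z → T (x ≼ y) → T (y ≼ z) → T (x ≼ z)
    natural  : ∀ x y → T (x ≼ y) → toℕ x ≤ toℕ y

open NatLabeledPoset public

_≅_ : ∀ {n m} → NatLabeledPoset n → NatLabeledPoset m → Set
_≅_ {n} {m} P Q = Σ (Fin n ↔ Fin m) λ f →
  ∀ x y → _≼_ P x y ≡ _≼_ Q (Inverse.to f x) (Inverse.to f y)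

IsAntichain : ∀ {n} → NatLabeledPoset n → Subset n → Set
IsAntichain P A = ∀ x y → x ∈ A → y ∈ A → T (_≼_ P x y) → x ≡ y

AllAntichains : ∀ {n i} → NatLabeledPoset n → Vec (Subset n) i → Set
AllAntichains {i = i} P As = ∀ (j : Fin i) → IsAntichain P (lookup As j)

unionAll : ∀ {n i} → Vec (Subset n) i → Subset n
unionAll = V.foldr _ _∪_ ⊥

IsMaxAntichainUnion : ∀ {n} → NatLabeledPoset n → ℕ → ℕ → Set
IsMaxAntichainUnion {n} P i k =
  (∃ λ (As : Vec (Subset n) i) → AllAntichains P As × ∣ unionAll As ∣ ≡ k)
  × (∀ (As : Vec (Subset n) i) → AllAntichains P As → ∣ unionAll As ∣ ≤ k)

-- given a (a i = a_i), the conjugate shape λ' has parts λ'_j = a_j - a_{j-1} (j ≥ 1)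
conjPart : (ℕ → ℕ) → ℕ → ℕ
conjPart a j = a j ∸ a (pred j)

-- λ_i = #{ j ≥ 1 : λ'_j ≥ i }  (λ'_j = 0 for j > n)
shapePart : ℕ → (ℕ → ℕ) → ℕ → ℕ
shapePart n a i = length (filterᵇ (λ j → i ≤ᵇ conjPart a j) (map suc (upTo n)))

HookShaped : ∀ {n} → NatLabeledPoset n → Set
HookShaped {n} P = ∃ λ (a : ℕ → ℕ) →
  (∀ i → IsMaxAntichainUnion P i (a i)) × shapePart n a 2 ≤ 1

private
  bump : List ℕ → List (List ℕ)
  bump []      = []
  bump (p ∷ α) = (suc p ∷ α) ∷ []

  ext : List ℕ → List (List ℕ)
  ext α = (1 ∷ α) ∷ bump α

compositions : ℕ → List (List ℕ)
compositions zero    = [] ∷ []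
compositions (suc n) = concatMap ext (compositions n)

D : List ℕ → List ℕ
D []            = []
D (p ∷ [])      = []
D (p ∷ q ∷ r)   = p ∷ map (λ d → p + d) (D (q ∷ r))

subsetᵇ : List ℕ → List ℕ → Bool
subsetᵇ xs ys = all (λ x → any (x ≡ᵇ_) ys) xs

-- coefficient of the monomial x_1^{β₁}⋯x_k^{β_k} in L_α (1 iff D(α) ⊆ D(β))
LCoeff : List ℕ → List ℕ → ℤ
LCoeff α β = if subsetᵇ (D α) (D β) then + 1 else 0ℤ

allMaps : (k n : ℕ) → List (Vec (Fin k) n)
allMaps k zero    = V.[] ∷ []
allMaps k (suc n) = concatMap (λ v → map (V._∷ v) (allFin k)) (allMaps k n)

orderPreservingᵇ : ∀ {n k} → NatLabeledPoset n → Vec (Fin k) n → Bool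
orderPreservingᵇ {n} P σ =
  all (λ x → all (λ y → not (_≼_ P x y) ∨ (toℕ (lookup σ x) ≤ᵇ toℕ (lookup σ y)))
                 (allFin n))
      (allFin n)

fiberSize : ∀ {n k} → Vec (Fin k) n → Fin k → ℕ
fiberSize {n} σ j = length (filterᵇ (λ x → toℕ (lookup σ x) ≡ᵇ toℕ j) (allFin n))

hasFibersᵇ : ∀ {n} (β : List ℕ) → Vec (Fin (length β)) n → Bool
hasFibersᵇ β σ = all (λ j → fiberSize σ j ≡ᵇ L.lookup β j) (allFin (length β))

-- coefficient of x_1^{β₁}⋯x_k^{β_k} in K_P: the number of P-partitions
-- σ : P → {1,…,k} with |σ⁻¹(j)| = β_j for all j
monomialCoeff : ∀ {n} → NatLabeledPoset n → List ℕ → ℕ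
monomialCoeff {n} P β =
  length (filterᵇ (λ σ → orderPreservingᵇ P σ ∧ hasFibersᵇ β σ) (allMaps (length β) n))

sumℤ : List ℤ → ℤ
sumℤ = foldr _+ℤ_ 0ℤ

-- c is the coefficient function of the expansion K_P = Σ_α c(α) L_α
-- (compared coefficientwise on the monomials x_1^{β₁}⋯x_k^{β_k})
IsLExpansion : ∀ {n} → NatLabeledPoset n → (List ℕ → ℤ) → Set
IsLExpansion {n} P c = ∀ β → β ∈ˡ compositions n →
  + monomialCoeff P β ≡ sumℤ (map (λ α → c α *ℤ LCoeff α β) (compositions n))

InSupp : ℕ → (List ℕ → ℤ) → List ℕ → Set
InSupp n c α = α ∈ˡ compositions n × c α ≢ 0ℤ

{-# OPTIONS --safe #-}
module Submission where

-- The support consists of the descent compositions of the linear extensions of P, so only these are to be compared.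
-- A strict order preserving map P → [k], read with each fibre in decreasing order, is a linear extension with
-- descents throughout every fibre; hence P and Q admit strict maps with the same fibre sizes.  In particular their
-- longest chains have the same length ℓ.  If P is hook shaped, the elements off a longest chain c₁ < … < c_ℓ form an
-- antichain, and P is recovered from the intervals I(x) = { j : c_j = x or c_j incomparable to x }: x < y iff I(x)
-- lies entirely before I(y), and σ : P → [ℓ] is strict iff σ(x) ∈ I(x) for all x.  The least possible number of
-- elements on the levels J is therefore #{ x : I(x) ⊆ J }, which P and Q share, and these numbers determine the
-- multiset of the I(x).

open import Defs
open import Data.Bool using (Bool; true; false; T; _∧_; _∨_; not; if_then_else_)
import Data.Bool.Properties as Bool
open import Data.Bool.ListAction using (all)
open import Data.Nat using (ℕ; zero; suc; _+_; _*_; _∸_; _≤_; _<_; pred; z≤n; s≤s; s≤s⁻¹; _≤?_; _<?_; _≟_; NonZero; >-nonZero; _≡ᵇ_; _≤ᵇ_)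
import Data.Nat.Properties as ℕ
open import Data.Integer using (ℤ; 0ℤ; 1ℤ) renaming (+_ to ℤ+_; _+_ to _+ℤ_; _*_ to _*ℤ_; _-_ to _-ℤ_; -_ to -ℤ_)
import Data.Integer.Properties as ℤ
open import Data.Fin as Fin using (Fin; zero; suc; toℕ)
import Data.Fin.Properties as Fin
open import Data.Fin.Permutation using (Permutation′; permutation; cast-id; _⟨$⟩ʳ_; _⟨$⟩ˡ_; inverseˡ; inverseʳ; flip; _∘ₚ_; id)
open import Data.Fin.Subset using (Subset; ∣_∣; _⊆_; _∪_; ⊤; inside; outside)
import Data.Fin.Subset as Sub
import Data.Fin.Subset.Properties as Sub
open import Data.List using (List; []; _∷_; _++_; map; concatMap; filter; filterᵇ; length; allFin; upTo; take)
open import Data.Nat.ListAction using (sum)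
import Data.List as List
import Data.List.Properties as List
open import Data.List.Membership.Propositional using (_∈_; _∉_)
import Data.List.Membership.Propositional.Properties as ∈
open import Data.List.Relation.Unary.All using (All; []; _∷_)
import Data.List.Relation.Unary.All as All
import Data.List.Relation.Unary.All.Properties as All
open import Data.List.Relation.Unary.AllPairs using ([]; _∷_)
import Data.List.Relation.Unary.AllPairs as AllPairs
import Data.List.Relation.Unary.AllPairs.Properties as AllPairs
open import Data.List.Relation.Unary.Any using (Any; here; there)
import Data.List.Relation.Unary.Any as Any
import Data.List.Relation.Unary.Any.Properties as Any
open import Data.List.Relation.Unary.Unique.Propositional using (Unique)
import Data.List.Relation.Unary.Unique.Propositional.Properties as Unique
open import Data.List.Relation.Binary.Permutation.Setoid using (onIndices)
import Data.List.Relation.Binary.Permutation.Setoid.Properties as ↭ₛProperties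
open import Data.List.Relation.Binary.Permutation.Propositional using (_↭_; ↭⇒↭ₛ; ↭-refl; ↭-sym; ↭-trans; prep)
import Data.List.Relation.Binary.Permutation.Propositional.Properties as ↭
open import Data.Vec using (Vec; lookup; tabulate; []; _∷_)
import Data.Vec as Vec
import Data.Vec.Properties as Vec
open import Data.Product using (Σ; ∃; ∃-syntax; _×_; _,_; proj₁; proj₂)
open import Data.Sum using (_⊎_; inj₁; inj₂; [_,_]′)
open import Data.Empty using (⊥; ⊥-elim)
open import Data.Unit using (tt)
open import Function using (_∘_; case_of_)
open import Function.Bundles using (_⇔_; Equivalence)
open import Function.Definitions using (Injective)
open import Algebra.Properties.AbelianGroup ℤ.+-0-abelianGroup using (∙-cancelʳ)
open import Algebra.Properties.CommutativeSemigroup ℤ.+-commutativeSemigroup using (interchange)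
open import Relation.Binary using (Rel; IsStrictTotalOrder; Tri; tri<; tri≈; tri>)
open import Relation.Binary.Structures.Biased using (isStrictTotalOrderᶜ)
import Relation.Binary.PropositionalEquality as Eq
import Relation.Binary.Construct.Flip.EqAndOrd as Flip
open import Relation.Unary using (Pred; Decidable)
open import Relation.Nullary using (¬_; Dec; yes; no; does; contradiction; ¬?; _×-dec_; _→-dec_; T?)
open import Relation.Nullary.Decidable using (dec-true; dec-false; toWitness; isYes≗does)
open import Relation.Binary.PropositionalEquality using (_≡_; _≢_; refl; sym; trans; cong; cong₂; subst; subst₂; module ≡-Reasoning)
open import Level using (0ℓ)

-- The support tells which descent sets occur, not how often, so numbers of strict maps cannot be
-- compared directly: only the existence of a strict map with given fibre sizes passes between P and
-- Q. Hence the use of a minimum over strict maps, which existence in both directions suffices to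
-- compare. Moreover Q is not assumed hook shaped. The hook condition therefore enters as a strict
-- map onto ℓ levels with at most one fibre that is not a singleton; this depends on fibre sizes
-- alone and so passes to Q. Such a map exists for P because the ℓ level sets are antichains
-- covering P, whence n ≤ a_ℓ, while λ_2 ≤ 1 gives a_{i+1} ≤ a_i + 1 for 1 ≤ i < n. So some
-- antichain has at least n - ℓ + 1 elements; meeting the chain at most once, it must contain every
-- element off the chain.

-- Counting in finite lists and finite sets

-- Each step removes from `ys` one occurrence of a partner of the head; by injectivity no other
-- member of `xs` relies on it. Using a relation instead of a function lets one correspondence be
-- counted from both ends.
length-≤ : {A B : Set} (R : A → B → Set) {xs : List A} {ys : List B} → Unique xs →
  (∀ {x} → x ∈ xs → ∃ λ y → y ∈ ys × R x y) →
  (∀ {x x′ y} → x ∈ xs → x′ ∈ xs → R x y → R x′ y → x ≡ x′) →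
  length xs ≤ length ys
length-≤ R {[]} _ _ _ = z≤n
length-≤ R {x ∷ xs} (x∉ ∷ uniq) total inj with total (here refl)
... | y , y∈ , Rxy with ∈.∈-∃++ y∈
... | as , bs , refl = subst (suc (length xs) ≤_) (sym (List.length-++-sucʳ as y bs))
    (s≤s (length-≤ R uniq total′ (λ p q → inj (there p) (there q))))
  where
  total′ : ∀ {x′} → x′ ∈ xs → ∃ λ y′ → y′ ∈ as ++ bs × R x′ y′
  total′ x′∈ with total (there x′∈)
  ... | y′ , y′∈ , r with ∈.∈-++⁻ as y′∈
  ... | inj₁ ∈as         = y′ , ∈.∈-++⁺ˡ ∈as , r
  ... | inj₂ (there ∈bs) = y′ , ∈.∈-++⁺ʳ as ∈bs , r
  ... | inj₂ (here refl) = contradiction (inj (here refl) (there x′∈) Rxy r) (All.lookup x∉ x′∈)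

length-filter-⊎ : {A : Set} {P Q R : Pred A 0ℓ} (P? : Decidable P) (Q? : Decidable Q) (R? : Decidable R) →
  (∀ {x} → P x → Q x ⊎ R x) → (∀ {x} → Q x → P x) → (∀ {x} → R x → P x) → (∀ {x} → Q x → ¬ R x) →
  ∀ xs → length (filter P? xs) ≡ length (filter Q? xs) + length (filter R? xs)
length-filter-⊎ P? Q? R? P⇒ Q⇒P R⇒P Q⇒¬R [] = refl
length-filter-⊎ P? Q? R? P⇒ Q⇒P R⇒P Q⇒¬R (x ∷ xs)
  with P? x | Q? x | R? x | length-filter-⊎ P? Q? R? P⇒ Q⇒P R⇒P Q⇒¬R xs
... | _     | yes q | yes r | _  = contradiction r (Q⇒¬R q)
... | yes _ | yes _ | no _  | ih = cong suc ih
... | yes _ | no _  | yes _ | ih = trans (cong suc ih) (sym (ℕ.+-suc _ _))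
... | no _  | no _  | no _  | ih = ih
... | yes p | no ¬q | no ¬r | _  = contradiction (P⇒ p) [ ¬q , ¬r ]′
... | no ¬p | yes q | no _  | _  = contradiction (Q⇒P q) ¬p
... | no ¬p | no _  | yes r | _  = contradiction (R⇒P r) ¬p

# : ∀ {n} {P : Pred (Fin n) 0ℓ} → Decidable P → ℕ
# P? = length (filter P? (allFin _))

module _ {m n} {P : Pred (Fin m) 0ℓ} {Q : Pred (Fin n) 0ℓ} (P? : Decidable P) (Q? : Decidable Q) where

  #-injection : (f : Fin m → Fin n) → Injective _≡_ _≡_ f → (∀ {x} → P x → Q (f x)) → # P? ≤ # Q?
  #-injection f inj P⇒Q = length-≤ (λ x y → f x ≡ y) (Unique.filter⁺ P? (Unique.allFin⁺ m))
    (λ {x} x∈ → f x , ∈.∈-filter⁺ Q? (∈.∈-allFin _) (P⇒Q (proj₂ (∈.∈-filter⁻ P? {xs = allFin m} x∈))) , refl)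
    (λ { _ _ p q → inj (trans p (sym q)) })

module _ {n} {P Q : Pred (Fin n) 0ℓ} (P? : Decidable P) (Q? : Decidable Q) where

  #-mono : (∀ {x} → P x → Q x) → # P? ≤ # Q?
  #-mono = #-injection P? Q? (λ x → x) (λ eq → eq)

  #-strict-mono : (∀ {x} → P x → Q x) → ∀ {z} → Q z → ¬ P z → # P? < # Q?
  #-strict-mono P⇒Q {z} Qz ¬Pz = length-≤ _≡_ {xs = z ∷ filter P? (allFin n)}
    (All.tabulate (λ { p∈ refl → ¬Pz (proj₂ (∈.∈-filter⁻ P? {xs = allFin n} p∈)) })
      ∷ Unique.filter⁺ P? (Unique.allFin⁺ n))
    (λ { (here refl) → _ , ∈.∈-filter⁺ Q? (∈.∈-allFin _) Qz , refl
       ; (there x∈) → _ , ∈.∈-filter⁺ Q? (∈.∈-allFin _) (P⇒Q (proj₂ (∈.∈-filter⁻ P? {xs = allFin n} x∈))) , refl })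
    (λ { _ _ refl refl → refl })

#-≤ : ∀ {n} {P : Pred (Fin n) 0ℓ} (P? : Decidable P) → # P? ≤ n
#-≤ {n} P? = ℕ.≤-trans (List.length-filter P? (allFin n)) (ℕ.≤-reflexive (List.length-tabulate {n = n} (λ i → i)))

#-toℕ< : ∀ {n} t → t ≤ n → # {n} (λ p → toℕ p <? t) ≡ t
#-toℕ< {n} t t≤n = ℕ.≤-antisym
  (subst (# <t ≤_) (List.length-tabulate {n = t} (λ i → i))
    (length-≤ (λ p i → toℕ p ≡ toℕ i) (Unique.filter⁺ <t (Unique.allFin⁺ n))
      (λ {p} p∈ → let p<t = proj₂ (∈.∈-filter⁻ <t {xs = allFin n} p∈) in
        Fin.fromℕ< p<t , ∈.∈-allFin _ , sym (Fin.toℕ-fromℕ< p<t))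
      (λ _ _ p q → Fin.toℕ-injective (trans p (sym q)))))
  (subst (_≤ # <t) (List.length-tabulate {n = t} (λ i → i))
    (length-≤ (λ i p → toℕ p ≡ toℕ i) (Unique.allFin⁺ t)
      (λ {i} _ → Fin.inject≤ i t≤n
        , ∈.∈-filter⁺ <t (∈.∈-allFin _) (subst (_< t) (sym (Fin.toℕ-inject≤ i t≤n)) (Fin.toℕ<n i))
        , Fin.toℕ-inject≤ i t≤n)
      (λ _ _ p q → Fin.toℕ-injective (trans (sym p) q))))
  where
  <t : Decidable {A = Fin n} (λ p → toℕ p < t)
  <t p = toℕ p <? t

-- Monotone self-maps, permutations and enumerations of total orders

StrictlyMonotone : ∀ {m n} → (Fin m → Fin n) → Set
StrictlyMonotone f = ∀ {i j} → i Fin.< j → f i Fin.< f j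

strictlyMonotone-≥ : ∀ {n} (f : Fin n → ℕ) → (∀ {i j} → i Fin.< j → f i < f j) → ∀ i → toℕ i ≤ f i
strictlyMonotone-≥ f mono zero = z≤n
strictlyMonotone-≥ f mono (suc i) = ℕ.≤-trans
    (s≤s (strictlyMonotone-≥ (λ j → pred (f (suc j))) mono′ i))
    (ℕ.≤-reflexive (ℕ.suc-pred (f (suc i)) {{positive i}}))
  where
  positive : ∀ j → NonZero (f (suc j))
  positive j = >-nonZero (ℕ.≤-<-trans z≤n (mono {zero} {suc j} (s≤s z≤n)))
  mono′ : ∀ {j k} → j Fin.< k → pred (f (suc j)) < pred (f (suc k))
  mono′ {j} j<k = ℕ.pred-mono-< {{positive j}} (mono (s≤s j<k))

-- Pigeonhole: by injectivity the image has at least as many members as `Fin n`, and strictly fewer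
-- once some `y` is missed.
injective⇒permutation : ∀ {n} (f : Fin n → Fin n) → Injective _≡_ _≡_ f →
  Σ (Permutation′ n) λ π → ∀ x → π ⟨$⟩ʳ x ≡ f x
injective⇒permutation {n} f inj =
  permutation f (λ y → proj₁ (surj y)) (λ y → proj₂ (surj y)) (λ x → inj (proj₂ (surj (f x)))) , λ _ → refl
  where
  surj : ∀ y → ∃ λ x → f x ≡ y
  surj y with Fin.any? (λ x → f x Fin.≟ y)
  ... | yes found = found
  ... | no ¬found = contradiction
      (#-strict-mono (λ x → Fin.any? (λ z → f z Fin.≟ x)) (λ x → T? true) (λ _ → tt) tt ¬found)
      (ℕ.≤⇒≯ (#-injection (λ x → T? true) (λ x → Fin.any? (λ z → f z Fin.≟ x)) f inj (λ {x} _ → x , refl)))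

⟨$⟩ʳ-injective : ∀ {n} (π : Permutation′ n) {x y} → π ⟨$⟩ʳ x ≡ π ⟨$⟩ʳ y → x ≡ y
⟨$⟩ʳ-injective π eq = trans (sym (inverseˡ π)) (trans (cong (π ⟨$⟩ˡ_) eq) (inverseˡ π))

strictlyMonotone⇒injective : ∀ {m n} (f : Fin m → Fin n) → StrictlyMonotone f → Injective _≡_ _≡_ f
strictlyMonotone⇒injective f mono {x} {y} eq with Fin.<-cmp x y
... | tri< x<y _ _ = contradiction (mono x<y) (Fin.<-irrefl eq)
... | tri≈ _ x≡y _ = x≡y
... | tri> _ _ y<x = contradiction (mono y<x) (Fin.<-irrefl (sym eq))

-- A strictly increasing map never falls below the identity. This applies to `f` and to its inverse,
-- which is increasing too, and the two bounds meet.
strictlyMonotone⇒id : ∀ {n} (f : Fin n → Fin n) → StrictlyMonotone f → ∀ i → f i ≡ i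
strictlyMonotone⇒id f mono i = Fin.≤-antisym
  (subst (f i Fin.≤_) (inverseˡ π) (subst (λ z → f i Fin.≤ π ⟨$⟩ˡ z) (sym (π≗f i))
    (strictlyMonotone-≥ (λ x → toℕ (π ⟨$⟩ˡ x)) inverse-mono (f i))))
  (strictlyMonotone-≥ (toℕ ∘ f) mono i)
  where
  perm = injective⇒permutation f (strictlyMonotone⇒injective f mono)
  π = proj₁ perm
  π≗f = proj₂ perm
  inverse-mono : ∀ {x y} → x Fin.< y → π ⟨$⟩ˡ x Fin.< π ⟨$⟩ˡ y
  inverse-mono {x} {y} x<y with Fin.<-cmp (π ⟨$⟩ˡ x) (π ⟨$⟩ˡ y)
  ... | tri< lt _ _ = lt
  ... | tri≈ _ eq _ = contradiction x<y (Fin.<-irrefl (⟨$⟩ʳ-injective (flip π) eq))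
  ... | tri> _ _ gt = contradiction x<y
    (ℕ.<-asym (subst₂ Fin._<_ (trans (sym (π≗f _)) (inverseʳ π)) (trans (sym (π≗f _)) (inverseʳ π)) (mono gt)))

module _ {n} {_⊏_ : Rel (Fin n) 0ℓ} (sto : IsStrictTotalOrder _≡_ _⊏_) where
  open IsStrictTotalOrder sto using (compare) renaming (trans to ⊏-trans; irrefl to ⊏-irrefl; _<?_ to _⊏?_)

  Enumerates : Permutation′ n → Set
  Enumerates w = ∀ {i j} → i Fin.< j → (w ⟨$⟩ʳ i) ⊏ (w ⟨$⟩ʳ j)

  -- The number of elements below `x` is its position; the enumeration is the inverse of this
  -- ranking.
  enumeration : ∃ Enumerates
  enumeration = w , enumerates
    where
    below : Fin n → ℕ
    below x = # (λ y → y ⊏? x)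
    below-mono : ∀ {x y} → x ⊏ y → below x < below y
    below-mono {x} {y} x⊏y = #-strict-mono (λ z → z ⊏? x) (λ z → z ⊏? y) (λ z⊏x → ⊏-trans z⊏x x⊏y) x⊏y (⊏-irrefl refl)
    below<n : ∀ x → below x < n
    below<n x = ℕ.<-≤-trans (#-strict-mono (λ y → y ⊏? x) (λ _ → T? true) (λ _ → tt) {x} tt (⊏-irrefl refl)) (#-≤ {n} (λ _ → T? true))
    rank : Fin n → Fin n
    rank x = Fin.fromℕ< (below<n x)
    rank-mono : ∀ {x y} → x ⊏ y → rank x Fin.< rank y
    rank-mono {x} {y} x⊏y = subst₂ _<_ (sym (Fin.toℕ-fromℕ< (below<n x))) (sym (Fin.toℕ-fromℕ< (below<n y))) (below-mono x⊏y)
    rank-injective : Injective _≡_ _≡_ rank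
    rank-injective {x} {y} eq with compare x y
    ... | tri< x⊏y _ _ = contradiction (rank-mono x⊏y) (Fin.<-irrefl eq)
    ... | tri≈ _ x≡y _ = x≡y
    ... | tri> _ _ y⊏x = contradiction (rank-mono y⊏x) (Fin.<-irrefl (sym eq))
    π = proj₁ (injective⇒permutation rank rank-injective)
    w = flip π
    enumerates : Enumerates w
    enumerates {i} {j} i<j with compare (w ⟨$⟩ʳ i) (w ⟨$⟩ʳ j)
    ... | tri< lt _ _ = lt
    ... | tri≈ _ eq _ = contradiction i<j (Fin.<-irrefl (⟨$⟩ʳ-injective w eq))
    ... | tri> _ _ gt = contradiction i<j (ℕ.<-asym (subst₂ Fin._<_ (inverseʳ π) (inverseʳ π) (rank-mono gt)))

  enumerates-reflects : ∀ w → Enumerates w → ∀ {x y} → x ⊏ y → w ⟨$⟩ˡ x Fin.< w ⟨$⟩ˡ y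
  enumerates-reflects w enum {x} {y} x⊏y with Fin.<-cmp (w ⟨$⟩ˡ x) (w ⟨$⟩ˡ y)
  ... | tri< lt _ _ = lt
  ... | tri≈ _ eq _ = contradiction x⊏y (⊏-irrefl (⟨$⟩ʳ-injective (flip w) eq))
  ... | tri> _ _ gt = contradiction
    (⊏-trans x⊏y (subst₂ _⊏_ (inverseʳ w) (inverseʳ w) (enum gt))) (⊏-irrefl refl)

  -- One enumeration followed by the inverse of the other is strictly increasing on positions, hence
  -- the identity.
  enumeration-unique : ∀ v w → Enumerates v → Enumerates w → ∀ i → v ⟨$⟩ʳ i ≡ w ⟨$⟩ʳ i
  enumeration-unique v w ev ew i = trans (sym (inverseʳ w))
    (cong (w ⟨$⟩ʳ_) (strictlyMonotone⇒id (λ k → w ⟨$⟩ˡ (v ⟨$⟩ʳ k)) (λ lt → enumerates-reflects w ew (ev lt)) i))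

-- Compositions, their sets `D`, and the coefficients of `L`

T-ext : ∀ {a b} → (T a → T b) → (T b → T a) → a ≡ b
T-ext {true}  {true}  _ _ = refl
T-ext {true}  {false} f _ = ⊥-elim (f tt)
T-ext {false} {true}  _ g = ⊥-elim (g tt)
T-ext {false} {false} _ _ = refl

module _ {A : Set} (p : A → Bool) where

  T-all⁺ : ∀ xs → (∀ {x} → x ∈ xs → T (p x)) → T (all p xs)
  T-all⁺ [] _ = tt
  T-all⁺ (x ∷ xs) h with p x | h (here refl)
  ... | true | _ = T-all⁺ xs (h ∘ there)

  T-all⁻ : ∀ xs → T (all p xs) → ∀ {x} → x ∈ xs → T (p x)
  T-all⁻ (x ∷ xs) h x∈ with p x in eq
  T-all⁻ (x ∷ xs) h (here refl) | true = subst T (sym eq) tt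
  T-all⁻ (x ∷ xs) h (there x∈)  | true = T-all⁻ xs h x∈

infix 4 _⊑_
_⊑_ : List ℕ → List ℕ → Set
xs ⊑ ys = ∀ {x} → x ∈ xs → x ∈ ys

subsetᵇ⇒⊑ : ∀ xs ys → T (subsetᵇ xs ys) → xs ⊑ ys
subsetᵇ⇒⊑ xs ys h {x} x∈ = Any.map (ℕ.≡ᵇ⇒≡ x _) (Any.any⁻ (x ≡ᵇ_) ys (T-all⁻ _ xs h x∈))

⊑⇒subsetᵇ : ∀ xs ys → xs ⊑ ys → T (subsetᵇ xs ys)
⊑⇒subsetᵇ xs ys h = T-all⁺ _ xs λ {x} x∈ → Any.any⁺ (x ≡ᵇ_) (Any.map (ℕ.≡⇒≡ᵇ x _) (h x∈))

indicator : Bool → ℤ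
indicator b = if b then 1ℤ else 0ℤ

LCoeff-cong : ∀ α β α′ β′ → (D α ⊑ D β → D α′ ⊑ D β′) → (D α′ ⊑ D β′ → D α ⊑ D β) → LCoeff α β ≡ LCoeff α′ β′
LCoeff-cong α β α′ β′ f g = cong indicator (T-ext
  (λ t → ⊑⇒subsetᵇ (D α′) (D β′) (f (subsetᵇ⇒⊑ (D α) (D β) t)))
  (λ t → ⊑⇒subsetᵇ (D α) (D β) (g (subsetᵇ⇒⊑ (D α′) (D β′) t))))

LCoeff-zero : ∀ α β → ¬ (D α ⊑ D β) → LCoeff α β ≡ 0ℤ
LCoeff-zero α β h = cong indicator (T-ext {b = false} (λ t → h (subsetᵇ⇒⊑ (D α) (D β) t)) λ ())

grow : List ℕ → List ℕ
grow []      = []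
grow (p ∷ α) = suc p ∷ α

Headed : List ℕ → Set
Headed α = ∃[ p ] ∃[ r ] α ≡ suc p ∷ r

concatMap-cong-local : {A B : Set} {f g : A → List B} {xs : List A} →
  All (λ x → f x ≡ g x) xs → concatMap f xs ≡ concatMap g xs
concatMap-cong-local []       = refl
concatMap-cong-local (p ∷ ps) = cong₂ _++_ p (concatMap-cong-local ps)

-- Agrees with the branching step of `compositions` except at `[]`, which has a single child there.
-- The inductions therefore start at size one, where every composition is `Headed`.
children : List ℕ → List (List ℕ)
children α = (1 ∷ α) ∷ grow α ∷ []

compositions-headed : ∀ n → All Headed (compositions (suc n))
compositions-suc : ∀ n → compositions (suc (suc n)) ≡ concatMap children (compositions (suc n))

compositions-suc n = concatMap-cong-local (All.map (λ { (_ , _ , refl) → refl }) (compositions-headed n))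

concatMap-children-headed : ∀ {xs} → All Headed xs → All Headed (concatMap children xs)
concatMap-children-headed [] = []
concatMap-children-headed ((p , r , refl) ∷ hs) =
  (0 , _ , refl) ∷ (suc p , r , refl) ∷ concatMap-children-headed hs

compositions-headed zero    = (0 , _ , refl) ∷ []
compositions-headed (suc n) = subst (All Headed) (sym (compositions-suc n)) (concatMap-children-headed (compositions-headed n))

∈-concatMap : {A B : Set} (f : A → List B) {x : A} {y : B} {xs : List A} → x ∈ xs → y ∈ f x → y ∈ concatMap f xs
∈-concatMap f x∈ y∈ = ∈.∈-concatMap⁺ f (Any.map (λ { refl → y∈ }) x∈)

Unique-children : ∀ {xs} → All Headed xs → Unique xs → Unique (concatMap children xs)
Unique-children [] [] = []
Unique-children {x ∷ xs} ((p , r , refl) ∷ hs) (x∉ ∷ uniq) =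
  ((λ ()) ∷ All.tabulate (λ { y∈ refl → case ∈-children⁻ hs y∈ of λ
      { (inj₁ (_ , γ∈ , refl)) → All.lookup x∉ γ∈ refl
      ; (inj₂ (_ , _ , _ , ())) } }))
  ∷ All.tabulate (λ { y∈ refl → case ∈-children⁻ hs y∈ of λ
      { (inj₁ (_ , _ , ()))
      ; (inj₂ (_ , _ , γ∈ , refl)) → All.lookup x∉ γ∈ refl } })
  ∷ Unique-children hs uniq
  where
  ∈-children⁻ : ∀ {xs y} → All Headed xs → y ∈ concatMap children xs →
    (∃[ γ ] (γ ∈ xs × y ≡ 1 ∷ γ)) ⊎ (∃[ p ] ∃[ r ] (suc p ∷ r ∈ xs × y ≡ suc (suc p) ∷ r))
  ∈-children⁻ (_ ∷ _) (here refl) = inj₁ (_ , here refl , refl)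
  ∈-children⁻ ((p , r , refl) ∷ _) (there (here refl)) = inj₂ (p , r , here refl , refl)
  ∈-children⁻ (_ ∷ hs) (there (there y∈)) with ∈-children⁻ hs y∈
  ... | inj₁ (γ , γ∈ , eq)     = inj₁ (γ , there γ∈ , eq)
  ... | inj₂ (p , r , γ∈ , eq) = inj₂ (p , r , there γ∈ , eq)

compositions-unique : ∀ n → Unique (compositions n)
compositions-unique zero          = [] ∷ []
compositions-unique (suc zero)    = [] ∷ []
compositions-unique (suc (suc n)) = subst Unique (sym (compositions-suc n))
  (Unique-children (compositions-headed n) (compositions-unique (suc n)))

-- Both children shift `D` by one, and only `1 ∷ α` acquires the element 1. This is the binary
-- recursion for subsets, transported to compositions.
D-grow : ∀ α → D (grow α) ≡ map suc (D α)
D-grow []          = refl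
D-grow (p ∷ [])    = refl
D-grow (p ∷ q ∷ r) = cong (suc p ∷_) (List.map-∘ (D (q ∷ r)))

D-1∷ : ∀ {α} → Headed α → D (1 ∷ α) ≡ 1 ∷ map suc (D α)
D-1∷ (_ , _ , refl) = refl

0∉D : ∀ {α} → Headed α → 0 ∉ D α
0∉D (p , q ∷ r , refl) (there 0∈) with ∈.∈-map⁻ _ 0∈
... | _ , _ , ()

suc-∈ : ∀ {x : ℕ} {xs} → suc x ∈ map suc xs → x ∈ xs
suc-∈ x∈ with ∈.∈-map⁻ suc x∈
... | _ , y∈ , refl = y∈

module _ {α β} (hα : Headed α) (hβ : Headed β) where

  private
    1∉ : ∀ {γ} → Headed γ → 1 ∉ map suc (D γ)
    1∉ hγ 1∈ = 0∉D hγ (suc-∈ 1∈)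

    ∉head : ∀ {x : ℕ} {xs} → x ≢ 0 → suc x ∈ 1 ∷ map suc xs → x ∈ xs
    ∉head x≢0 (here refl) = contradiction refl x≢0
    ∉head x≢0 (there x∈)  = suc-∈ x∈

    ≢0 : ∀ {x} → x ∈ D α → x ≢ 0
    ≢0 x∈ refl = 0∉D hα x∈

    suc-⊑ : D α ⊑ D β → map suc (D α) ⊑ map suc (D β)
    suc-⊑ h x∈ with ∈.∈-map⁻ suc x∈
    ... | _ , y∈ , refl = ∈.∈-map⁺ suc (h y∈)

  LCoeff-1∷-1∷ : LCoeff (1 ∷ α) (1 ∷ β) ≡ LCoeff α β
  LCoeff-1∷-1∷ = LCoeff-cong (1 ∷ α) (1 ∷ β) α β
    (λ h {x} x∈ → ∉head (≢0 x∈) (subst (suc x ∈_) (D-1∷ hβ)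
        (h (subst (suc x ∈_) (sym (D-1∷ hα)) (there (∈.∈-map⁺ suc x∈))))))
    (λ h {x} x∈ → subst (x ∈_) (sym (D-1∷ hβ)) (case subst (x ∈_) (D-1∷ hα) x∈ of λ
        { (here refl) → here refl ; (there x∈′) → there (suc-⊑ h x∈′) }))

  LCoeff-1∷-grow : LCoeff (1 ∷ α) (grow β) ≡ 0ℤ
  LCoeff-1∷-grow = LCoeff-zero (1 ∷ α) (grow β)
    λ h → 1∉ hβ (subst (1 ∈_) (D-grow β) (h (subst (1 ∈_) (sym (D-1∷ hα)) (here refl))))

  LCoeff-grow-grow : LCoeff (grow α) (grow β) ≡ LCoeff α β
  LCoeff-grow-grow = LCoeff-cong (grow α) (grow β) α β
    (λ h {x} x∈ → suc-∈ (subst (suc x ∈_) (D-grow β) (h (subst (suc x ∈_) (sym (D-grow α)) (∈.∈-map⁺ suc x∈)))))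
    (λ h {x} x∈ → subst (x ∈_) (sym (D-grow β)) (suc-⊑ h (subst (x ∈_) (D-grow α) x∈)))

-- Linear independence of the `L` functions

Σℤ : {A : Set} → List A → (A → ℤ) → ℤ
Σℤ xs f = sumℤ (map f xs)

module _ {A : Set} where

  Σℤ-cong : ∀ {xs} {f g : A → ℤ} → (∀ {x} → x ∈ xs → f x ≡ g x) → Σℤ xs f ≡ Σℤ xs g
  Σℤ-cong {[]}     h = refl
  Σℤ-cong {x ∷ xs} h = cong₂ _+ℤ_ (h (here refl)) (Σℤ-cong (h ∘ there))

  Σℤ-zero : ∀ xs → Σℤ {A} xs (λ _ → 0ℤ) ≡ 0ℤ
  Σℤ-zero []       = refl
  Σℤ-zero (x ∷ xs) = trans (ℤ.+-identityˡ _) (Σℤ-zero xs)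

  Σℤ-+ : ∀ xs (f g : A → ℤ) → Σℤ xs (λ x → f x +ℤ g x) ≡ Σℤ xs f +ℤ Σℤ xs g
  Σℤ-+ []       f g = refl
  Σℤ-+ (x ∷ xs) f g = trans (cong (f x +ℤ g x +ℤ_) (Σℤ-+ xs f g)) (interchange (f x) (g x) (Σℤ xs f) (Σℤ xs g))

Σℤ-children : ∀ xs (f : List ℕ → ℤ) → Σℤ (concatMap children xs) f ≡ Σℤ xs (f ∘ (1 ∷_)) +ℤ Σℤ xs (f ∘ grow)
Σℤ-children []       f = refl
Σℤ-children (α ∷ xs) f = begin
  f (1 ∷ α) +ℤ (f (grow α) +ℤ Σℤ (concatMap children xs) f)
    ≡⟨ ℤ.+-assoc (f (1 ∷ α)) _ _ ⟨
  (f (1 ∷ α) +ℤ f (grow α)) +ℤ Σℤ (concatMap children xs) f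
    ≡⟨ cong (f (1 ∷ α) +ℤ f (grow α) +ℤ_) (Σℤ-children xs f) ⟩
  (f (1 ∷ α) +ℤ f (grow α)) +ℤ (Σℤ xs (f ∘ (1 ∷_)) +ℤ Σℤ xs (f ∘ grow))
    ≡⟨ interchange (f (1 ∷ α)) (f (grow α)) _ _ ⟩
  (f (1 ∷ α) +ℤ Σℤ xs (f ∘ (1 ∷_))) +ℤ (f (grow α) +ℤ Σℤ xs (f ∘ grow))  ∎
  where open ≡-Reasoning

LSum : ℕ → (List ℕ → ℤ) → List ℕ → ℤ
LSum n g β = Σℤ (compositions n) (λ α → g α *ℤ LCoeff α β)

LSumKernelTrivial : ℕ → Set
LSumKernelTrivial n = ∀ (g : List ℕ → ℤ) → (∀ {β} → β ∈ compositions n → LSum n g β ≡ 0ℤ) →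
  ∀ {β} → β ∈ compositions n → g β ≡ 0ℤ

-- Split by the two kinds of children, the matrix `LCoeff` is block triangular with two copies of
-- the smaller matrix on the diagonal. Testing at `grow β` isolates the values of `g` on grown
-- compositions; once these vanish, testing at `1 ∷ β` isolates the others.
LSum-kernel-suc : ∀ n → LSumKernelTrivial (suc n) → LSumKernelTrivial (suc (suc n))
LSum-kernel-suc n ih g h = kernel
  where
  comps = compositions (suc n)
  headed : ∀ {α} → α ∈ comps → Headed α
  headed = All.lookup (compositions-headed n)
  1∷-∈ : ∀ {β} → β ∈ comps → 1 ∷ β ∈ compositions (suc (suc n))
  1∷-∈ β∈ = subst (_ ∈_) (sym (compositions-suc n)) (∈-concatMap children β∈ (here refl))
  grow-∈ : ∀ {β} → β ∈ comps → grow β ∈ compositions (suc (suc n))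
  grow-∈ β∈ = subst (_ ∈_) (sym (compositions-suc n)) (∈-concatMap children β∈ (there (here refl)))
  split : ∀ β → LSum (suc (suc n)) g β ≡
    Σℤ comps (λ α → g (1 ∷ α) *ℤ LCoeff (1 ∷ α) β) +ℤ Σℤ comps (λ α → g (grow α) *ℤ LCoeff (grow α) β)
  split β = trans (cong (λ xs → Σℤ xs (λ α → g α *ℤ LCoeff α β)) (compositions-suc n)) (Σℤ-children comps _)
  grow-zero : ∀ {β} → β ∈ comps → g (grow β) ≡ 0ℤ
  grow-zero = ih (g ∘ grow) λ {β} β∈ → begin
    LSum (suc n) (g ∘ grow) β
      ≡⟨ Σℤ-cong {xs = comps} (λ {α} α∈ → cong (g (grow α) *ℤ_) (sym (LCoeff-grow-grow (headed α∈) (headed β∈)))) ⟩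
    Σℤ comps (λ α → g (grow α) *ℤ LCoeff (grow α) (grow β))
      ≡⟨ ℤ.+-identityˡ _ ⟨
    0ℤ +ℤ Σℤ comps (λ α → g (grow α) *ℤ LCoeff (grow α) (grow β))
      ≡⟨ cong (_+ℤ Σℤ comps (λ α → g (grow α) *ℤ LCoeff (grow α) (grow β))) (trans (Σℤ-cong {xs = comps} (λ {α} α∈ →
           trans (cong (g (1 ∷ α) *ℤ_) (LCoeff-1∷-grow (headed α∈) (headed β∈))) (ℤ.*-zeroʳ (g (1 ∷ α))))) (Σℤ-zero comps)) ⟨
    Σℤ comps (λ α → g (1 ∷ α) *ℤ LCoeff (1 ∷ α) (grow β)) +ℤ Σℤ comps (λ α → g (grow α) *ℤ LCoeff (grow α) (grow β))
      ≡⟨ split (grow β) ⟨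
    LSum (suc (suc n)) g (grow β)
      ≡⟨ h (grow-∈ β∈) ⟩
    0ℤ ∎
    where open ≡-Reasoning
  1∷-zero : ∀ {β} → β ∈ comps → g (1 ∷ β) ≡ 0ℤ
  1∷-zero = ih (g ∘ (1 ∷_)) λ {β} β∈ → begin
    LSum (suc n) (g ∘ (1 ∷_)) β
      ≡⟨ Σℤ-cong {xs = comps} (λ {α} α∈ → cong (g (1 ∷ α) *ℤ_) (sym (LCoeff-1∷-1∷ (headed α∈) (headed β∈)))) ⟩
    Σℤ comps (λ α → g (1 ∷ α) *ℤ LCoeff (1 ∷ α) (1 ∷ β))
      ≡⟨ ℤ.+-identityʳ _ ⟨
    Σℤ comps (λ α → g (1 ∷ α) *ℤ LCoeff (1 ∷ α) (1 ∷ β)) +ℤ 0ℤ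
      ≡⟨ cong (Σℤ comps (λ α → g (1 ∷ α) *ℤ LCoeff (1 ∷ α) (1 ∷ β)) +ℤ_) (trans (Σℤ-cong {xs = comps} (λ {α} α∈ →
           trans (cong (_*ℤ LCoeff (grow α) (1 ∷ β)) (grow-zero α∈)) (ℤ.*-zeroˡ (LCoeff (grow α) (1 ∷ β))))) (Σℤ-zero comps)) ⟨
    Σℤ comps (λ α → g (1 ∷ α) *ℤ LCoeff (1 ∷ α) (1 ∷ β)) +ℤ Σℤ comps (λ α → g (grow α) *ℤ LCoeff (grow α) (1 ∷ β))
      ≡⟨ split (1 ∷ β) ⟨
    LSum (suc (suc n)) g (1 ∷ β)
      ≡⟨ h (1∷-∈ β∈) ⟩
    0ℤ ∎
    where open ≡-Reasoning
  kernel : ∀ {β} → β ∈ compositions (suc (suc n)) → g β ≡ 0ℤ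
  kernel {β} β∈ = All.lookup (all-zero comps (λ α∈ → α∈)) (subst (β ∈_) (compositions-suc n) β∈)
    where
    all-zero : ∀ xs → (∀ {α} → α ∈ xs → α ∈ comps) → All (λ α → g α ≡ 0ℤ) (concatMap children xs)
    all-zero []       _ = []
    all-zero (α ∷ xs) ⊆ = 1∷-zero (⊆ (here refl)) ∷ grow-zero (⊆ (here refl)) ∷ all-zero xs (⊆ ∘ there)

LSum-kernel : ∀ n → LSumKernelTrivial n
LSum-kernel zero g h (here refl) = trans (sym (trans (ℤ.+-identityʳ _) (ℤ.*-identityʳ (g [])))) (h (here refl))
LSum-kernel (suc zero) g h (here refl) =
  trans (sym (trans (ℤ.+-identityʳ _) (ℤ.*-identityʳ (g (1 ∷ []))))) (h (here refl))
LSum-kernel (suc (suc n)) = LSum-kernel-suc n (LSum-kernel (suc n))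

-- Uniqueness of the expansion: it allows an arbitrary coefficient function `c` to be identified
-- with a count of linear extensions.
LSum-injective : ∀ n (c e : List ℕ → ℤ) → (∀ {β} → β ∈ compositions n → LSum n c β ≡ LSum n e β) →
  ∀ {β} → β ∈ compositions n → c β ≡ e β
LSum-injective n c e h β∈ = ℤ.i-j≡0⇒i≡j _ _ (LSum-kernel n (λ α → c α -ℤ e α) difference β∈)
  where
  open ≡-Reasoning
  difference : ∀ {β} → β ∈ compositions n → LSum n (λ α → c α -ℤ e α) β ≡ 0ℤ
  difference {β} β∈ = ∙-cancelʳ (LSum n e β) _ _ (begin
    LSum n (λ α → c α -ℤ e α) β +ℤ LSum n e β
      ≡⟨ Σℤ-+ (compositions n) _ _ ⟨
    Σℤ (compositions n) (λ α → (c α -ℤ e α) *ℤ LCoeff α β +ℤ e α *ℤ LCoeff α β)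
      ≡⟨ Σℤ-cong {xs = compositions n} (λ {α} _ → trans (sym (ℤ.*-distribʳ-+ (LCoeff α β) (c α -ℤ e α) (e α)))
           (cong (_*ℤ LCoeff α β) (trans (ℤ.+-assoc (c α) (-ℤ e α) (e α))
             (trans (cong (c α +ℤ_) (ℤ.+-inverseˡ (e α))) (ℤ.+-identityʳ (c α)))))) ⟩
    LSum n c β
      ≡⟨ h β∈ ⟩
    LSum n e β
      ≡⟨ ℤ.+-identityˡ _ ⟨
    0ℤ +ℤ LSum n e β ∎)

-- Compositions from descent predicates, and counting by a key

-- Inverse to `D`: the composition of `n` whose `D` consists of the `i` with `0 < i < n` and `d i`.
-- Whether 1 belongs to it selects the child, and `d` is shifted for the rest.
composition : (ℕ → Bool) → ℕ → List ℕ
composition d zero          = []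
composition d (suc zero)    = 1 ∷ []
composition d (suc (suc n)) = if d 1 then 1 ∷ composition (d ∘ suc) (suc n) else grow (composition (d ∘ suc) (suc n))

composition-∈ : ∀ d n → composition d n ∈ compositions n
composition-∈ d zero       = here refl
composition-∈ d (suc zero) = here refl
composition-∈ d (suc (suc n)) = subst (composition d (suc (suc n)) ∈_) (sym (compositions-suc n))
  (∈-concatMap children (composition-∈ (d ∘ suc) (suc n)) child)
  where
  child : composition d (suc (suc n)) ∈ children (composition (d ∘ suc) (suc n))
  child with d 1
  ... | true  = here refl
  ... | false = there (here refl)

composition-headed : ∀ d n → Headed (composition d (suc n))
composition-headed d n = All.lookup (compositions-headed n) (composition-∈ d (suc n))

D-composition⁻ : ∀ d n {i} → suc i ∈ D (composition d n) → suc i < n × T (d (suc i))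
D-composition⁻ d (suc (suc n)) {i} i∈ with d 1 in eq
D-composition⁻ d (suc (suc n)) {i} i∈ | true
  with subst (suc i ∈_) (D-1∷ (composition-headed (d ∘ suc) n)) i∈
... | here refl = s≤s (s≤s z≤n) , subst T (sym eq) tt
... | there i∈′ with i | suc-∈ i∈′
... | zero  | 0∈ = contradiction 0∈ (0∉D (composition-headed (d ∘ suc) n))
... | suc j | j∈ with D-composition⁻ (d ∘ suc) (suc n) j∈
... | j<n , t = s≤s j<n , t
D-composition⁻ d (suc (suc n)) {i} i∈ | false
  with i | suc-∈ (subst (suc i ∈_) (D-grow (composition (d ∘ suc) (suc n))) i∈)
... | zero  | 0∈ = contradiction 0∈ (0∉D (composition-headed (d ∘ suc) n))
... | suc j | j∈ with D-composition⁻ (d ∘ suc) (suc n) j∈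
... | j<n , t = s≤s j<n , t

D-composition⁺ : ∀ d n {i} → suc i < n → T (d (suc i)) → suc i ∈ D (composition d n)
D-composition⁺ d (suc zero) (s≤s ()) t
D-composition⁺ d (suc (suc n)) {i} i<n t with d 1 in eq
D-composition⁺ d (suc (suc n)) {zero} i<n t | true =
  subst (1 ∈_) (sym (D-1∷ (composition-headed (d ∘ suc) n))) (here refl)
D-composition⁺ d (suc (suc n)) {suc i} (s≤s i<n) t | true =
  subst (suc (suc i) ∈_) (sym (D-1∷ (composition-headed (d ∘ suc) n)))
    (there (∈.∈-map⁺ suc (D-composition⁺ (d ∘ suc) (suc n) i<n t)))
D-composition⁺ d (suc (suc n)) {zero} i<n t | false = ⊥-elim (subst T eq t)
D-composition⁺ d (suc (suc n)) {suc i} (s≤s i<n) t | false =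
  subst (suc (suc i) ∈_) (sym (D-grow (composition (d ∘ suc) (suc n))))
    (∈.∈-map⁺ suc (D-composition⁺ (d ∘ suc) (suc n) i<n t))

_≟ˡ_ : (α β : List ℕ) → Dec (α ≡ β)
_≟ˡ_ = List.≡-dec _≟_

Σℤ-indicator : ∀ {xs} → Unique xs → (F : List ℕ → ℤ) → ∀ {κ} → κ ∈ xs →
  Σℤ xs (λ α → indicator (does (κ ≟ˡ α)) *ℤ F α) ≡ F κ
Σℤ-indicator {x ∷ xs} (x∉ ∷ uniq) F {κ} (here refl) = begin
  indicator (does (κ ≟ˡ κ)) *ℤ F κ +ℤ Σℤ xs (λ α → indicator (does (κ ≟ˡ α)) *ℤ F α)
    ≡⟨ cong₂ (λ b s → indicator b *ℤ F κ +ℤ s) (dec-true (κ ≟ˡ κ) refl)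
         (trans (Σℤ-cong {xs = xs} (λ {α} α∈ → cong (λ b → indicator b *ℤ F α) (dec-false (κ ≟ˡ α) (All.lookup x∉ α∈)))) (Σℤ-zero xs)) ⟩
  1ℤ *ℤ F κ +ℤ 0ℤ
    ≡⟨ trans (ℤ.+-identityʳ _) (ℤ.*-identityˡ _) ⟩
  F κ ∎
  where open ≡-Reasoning
Σℤ-indicator {x ∷ xs} (x∉ ∷ uniq) F {κ} (there κ∈) = begin
  indicator (does (κ ≟ˡ x)) *ℤ F x +ℤ Σℤ xs (λ α → indicator (does (κ ≟ˡ α)) *ℤ F α)
    ≡⟨ cong₂ (λ b s → indicator b *ℤ F x +ℤ s) (dec-false (κ ≟ˡ x) (λ { refl → All.lookup x∉ κ∈ refl }))
         (Σℤ-indicator uniq F κ∈) ⟩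
  0ℤ +ℤ F κ
    ≡⟨ ℤ.+-identityˡ _ ⟩
  F κ ∎
  where open ≡-Reasoning

-- Every `w` contributes to exactly one term, that of its key, because the keys lie in a list
-- without repetitions. With the descent composition as key, a count of linear extensions becomes an
-- `LSum`.
length-filter-key : {W : Set} (κ : W → List ℕ) (b : List ℕ → Bool) {xs : List (List ℕ)} → Unique xs → (∀ w → κ w ∈ xs) →
  ∀ E → ℤ+ length (filterᵇ (b ∘ κ) E) ≡ Σℤ xs (λ α → ℤ+ length (filter (λ w → κ w ≟ˡ α) E) *ℤ indicator (b α))
length-filter-key κ b {xs} uniq κ∈ [] = sym (trans (Σℤ-cong {xs = xs} (λ {α} _ → ℤ.*-zeroˡ (indicator (b α)))) (Σℤ-zero xs))
length-filter-key κ b {xs} uniq κ∈ (w ∷ E) = begin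
  ℤ+ length (filterᵇ (b ∘ κ) (w ∷ E))
    ≡⟨ head-count ⟩
  indicator (b (κ w)) +ℤ ℤ+ length (filterᵇ (b ∘ κ) E)
    ≡⟨ cong₂ _+ℤ_ (sym (Σℤ-indicator uniq (indicator ∘ b) (κ∈ w))) (length-filter-key κ b uniq κ∈ E) ⟩
  Σℤ xs (λ α → indicator (does (κ w ≟ˡ α)) *ℤ indicator (b α)) +ℤ
  Σℤ xs (λ α → ℤ+ length (filter (λ w → κ w ≟ˡ α) E) *ℤ indicator (b α))
    ≡⟨ Σℤ-+ xs _ _ ⟨
  Σℤ xs (λ α → indicator (does (κ w ≟ˡ α)) *ℤ indicator (b α) +ℤ ℤ+ length (filter (λ w → κ w ≟ˡ α) E) *ℤ indicator (b α))
    ≡⟨ Σℤ-cong {xs = xs} (λ {α} _ → trans (sym (ℤ.*-distribʳ-+ (indicator (b α)) (indicator (does (κ w ≟ˡ α))) _))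
         (cong (_*ℤ indicator (b α)) (key-count α))) ⟩
  Σℤ xs (λ α → ℤ+ length (filter (λ w → κ w ≟ˡ α) (w ∷ E)) *ℤ indicator (b α)) ∎
  where
  open ≡-Reasoning
  head-count : ℤ+ length (filterᵇ (b ∘ κ) (w ∷ E)) ≡ indicator (b (κ w)) +ℤ ℤ+ length (filterᵇ (b ∘ κ) E)
  head-count with b (κ w)
  ... | true  = refl
  ... | false = refl
  key-count : ∀ α → indicator (does (κ w ≟ˡ α)) +ℤ ℤ+ length (filter (λ w → κ w ≟ˡ α) E) ≡ ℤ+ length (filter (λ w → κ w ≟ˡ α) (w ∷ E))
  key-count α with does (κ w ≟ˡ α)
  ... | true  = refl
  ... | false = refl

-- Partial sums, fibre sizes and block maps

psum : List ℕ → ℕ → ℕ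
psum β t = sum (take t β)

psum-suc : ∀ β j → psum β (suc (toℕ j)) ≡ psum β (toℕ j) + List.lookup β j
psum-suc (b ∷ β) zero    = ℕ.+-identityʳ b
psum-suc (b ∷ β) (suc j) = trans (cong (b +_) (psum-suc β j)) (sym (ℕ.+-assoc b _ _))

psum-length : ∀ β → psum β (length β) ≡ sum β
psum-length []      = refl
psum-length (b ∷ β) = cong (b +_) (psum-length β)

psum-≤ : ∀ β t → psum β t ≤ sum β
psum-≤ β       zero    = z≤n
psum-≤ []      (suc t) = z≤n
psum-≤ (b ∷ β) (suc t) = ℕ.+-monoʳ-≤ b (psum-≤ β t)

psum-∈-D : ∀ β t → suc t < length β → psum β (suc t) ∈ D β
psum-∈-D (b ∷ [])    _       (s≤s ())
psum-∈-D (b ∷ c ∷ β) zero    _        = here (ℕ.+-identityʳ b)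
psum-∈-D (b ∷ c ∷ β) (suc t) (s≤s lt) = there (∈.∈-map⁺ (b +_) (psum-∈-D (c ∷ β) t lt))

D-psum : ∀ β {i} → i ∈ D β → ∃[ t ] (t ≤ length β × i ≡ psum β t)
D-psum (b ∷ c ∷ β) (here refl) = 1 , s≤s z≤n , sym (ℕ.+-identityʳ b)
D-psum (b ∷ c ∷ β) (there i∈) =
  let _ , j∈ , i≡b+j = ∈.∈-map⁻ (b +_) i∈
      t , t≤ , j≡    = D-psum (c ∷ β) j∈
  in suc t , s≤s t≤ , trans i≡b+j (cong (b +_) j≡)

sum-children : ∀ {m xs} → All Headed xs → All (λ α → sum α ≡ m) xs → All (λ α → sum α ≡ suc m) (concatMap children xs)
sum-children [] [] = []
sum-children ((_ , _ , refl) ∷ hs) (eq ∷ eqs) = cong suc eq ∷ cong suc eq ∷ sum-children hs eqs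

sum-compositions : ∀ n → All (λ α → sum α ≡ n) (compositions n)
sum-compositions zero          = refl ∷ []
sum-compositions (suc zero)    = refl ∷ []
sum-compositions (suc (suc n)) = subst (All _) (sym (compositions-suc n))
  (sum-children (compositions-headed n) (sum-compositions (suc n)))

Monotone : ∀ {m n} → (Fin m → Fin n) → Set
Monotone f = ∀ {i j} → i Fin.≤ j → f i Fin.≤ f j

-- Fibre sizes in cumulative form. For a monotone map this says that the values below `t` fill
-- exactly the first `psum β t` positions, so no fibre has to be handled on its own.
Content : ∀ {n} (β : List ℕ) → (Fin n → Fin (length β)) → Set
Content β f = ∀ t → t ≤ length β → # (λ p → toℕ (f p) <? t) ≡ psum β t

#-<-suc : ∀ {n k} (f : Fin n → Fin k) (j : Fin k) →
  # (λ p → toℕ (f p) <? suc (toℕ j)) ≡ # (λ p → toℕ (f p) <? toℕ j) + # (λ p → T? (toℕ (f p) ≡ᵇ toℕ j))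
#-<-suc {n} f j = length-filter-⊎ (λ p → toℕ (f p) <? suc (toℕ j)) (λ p → toℕ (f p) <? toℕ j) (λ p → T? (toℕ (f p) ≡ᵇ toℕ j))
  (λ lt → [ inj₁ , inj₂ ∘ ℕ.≡⇒≡ᵇ _ _ ]′ (ℕ.m<1+n⇒m<n∨m≡n lt)) ℕ.m<n⇒m<1+n
  (λ eq → s≤s (ℕ.≤-reflexive (ℕ.≡ᵇ⇒≡ _ _ eq))) (λ lt eq → ℕ.<-irrefl (ℕ.≡ᵇ⇒≡ _ _ eq) lt) (allFin n)

module _ {n} (β : List ℕ) (σ : Vec (Fin (length β)) n) where

  hasFibers⇒Content : T (hasFibersᵇ β σ) → Content β (lookup σ)
  hasFibers⇒Content h zero _ = cong length (List.filter-none (λ p → toℕ (lookup σ p) <? 0) {xs = allFin n} (All.tabulate λ _ ()))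
  hasFibers⇒Content h (suc t) t<k = begin
    # (λ p → toℕ (lookup σ p) <? suc t)
      ≡⟨ cong (λ s → # (λ p → toℕ (lookup σ p) <? suc s)) (Fin.toℕ-fromℕ< t<k) ⟨
    # (λ p → toℕ (lookup σ p) <? suc (toℕ j))
      ≡⟨ #-<-suc (lookup σ) j ⟩
    # (λ p → toℕ (lookup σ p) <? toℕ j) + # (λ p → T? (toℕ (lookup σ p) ≡ᵇ toℕ j))
      ≡⟨ cong₂ _+_ (trans (cong (λ s → # (λ p → toℕ (lookup σ p) <? s)) (Fin.toℕ-fromℕ< t<k)) (hasFibers⇒Content h t (ℕ.<⇒≤ t<k)))
           (ℕ.≡ᵇ⇒≡ _ _ (T-all⁻ _ (allFin (length β)) h (∈.∈-allFin j))) ⟩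
    psum β t + List.lookup β j
      ≡⟨ cong (λ s → psum β s + List.lookup β j) (Fin.toℕ-fromℕ< t<k) ⟨
    psum β (toℕ j) + List.lookup β j
      ≡⟨ psum-suc β j ⟨
    psum β (suc (toℕ j))
      ≡⟨ cong (psum β ∘ suc) (Fin.toℕ-fromℕ< t<k) ⟩
    psum β (suc t) ∎
    where
    open ≡-Reasoning
    j = Fin.fromℕ< t<k

  Content⇒hasFibers : Content β (lookup σ) → T (hasFibersᵇ β σ)
  Content⇒hasFibers h = T-all⁺ _ (allFin (length β)) λ {j} _ → ℕ.≡⇒≡ᵇ _ _ (ℕ.+-cancelˡ-≡ (psum β (toℕ j)) _ _ (begin
    psum β (toℕ j) + # (λ p → T? (toℕ (lookup σ p) ≡ᵇ toℕ j))
      ≡⟨ cong (_+ # (λ p → T? (toℕ (lookup σ p) ≡ᵇ toℕ j))) (h (toℕ j) (ℕ.<⇒≤ (Fin.toℕ<n j))) ⟨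
    # (λ p → toℕ (lookup σ p) <? toℕ j) + # (λ p → T? (toℕ (lookup σ p) ≡ᵇ toℕ j))
      ≡⟨ #-<-suc (lookup σ) j ⟨
    # (λ p → toℕ (lookup σ p) <? suc (toℕ j))
      ≡⟨ h (suc (toℕ j)) (Fin.toℕ<n j) ⟩
    psum β (suc (toℕ j))
      ≡⟨ psum-suc β j ⟩
    psum β (toℕ j) + List.lookup β j ∎))
    where open ≡-Reasoning

Content-∘ : ∀ {n} β (π : Permutation′ n) {f g} → (∀ x → f x ≡ g (π ⟨$⟩ʳ x)) → Content {n} β g → Content β f
Content-∘ β π {f} {g} f≗g∘π h t t≤k = trans (ℕ.≤-antisym
  (#-injection (λ p → toℕ (f p) <? t) (λ p → toℕ (g p) <? t) (π ⟨$⟩ʳ_) (⟨$⟩ʳ-injective π)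
    (λ {x} → subst (λ z → toℕ z < t) (f≗g∘π x)))
  (#-injection (λ p → toℕ (g p) <? t) (λ p → toℕ (f p) <? t) (π ⟨$⟩ˡ_) (⟨$⟩ʳ-injective (flip π))
    (λ {x} → subst (λ z → toℕ z < t) (sym (trans (f≗g∘π _) (cong g (inverseʳ π)))))))
  (h t t≤k)

module _ {n β} {f : Fin n → Fin (length β)} (mono : Monotone f) (content : Content β f) where

  -- By monotonicity the positions with value below `t` form an initial segment; it contains
  -- everything up to `p`, and its length is `psum β t`.
  monotone-content⁺ : ∀ {p t} → t ≤ length β → toℕ (f p) < t → toℕ p < psum β t
  monotone-content⁺ {p} {t} t≤k lt = subst₂ _≤_ (#-toℕ< (suc (toℕ p)) (Fin.toℕ<n p)) (content t t≤k)
    (#-mono (λ q → toℕ q <? suc (toℕ p)) (λ q → toℕ (f q) <? t) (λ { (s≤s q≤p) → ℕ.≤-<-trans (mono q≤p) lt }))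

  monotone-content⁻ : ∀ {p t} → t ≤ length β → toℕ p < psum β t → toℕ (f p) < t
  monotone-content⁻ {p} {t} t≤k lt with toℕ (f p) <? t
  ... | yes fp<t = fp<t
  ... | no fp≮t = contradiction lt (ℕ.≤⇒≯ (subst₂ _≤_ (content t t≤k) (#-toℕ< (toℕ p) (ℕ.<⇒≤ (Fin.toℕ<n p)))
    (#-mono (λ q → toℕ (f q) <? t) (λ q → toℕ q <? toℕ p)
      (λ fq<t → ℕ.≰⇒> (λ p≤q → fp≮t (ℕ.≤-<-trans (mono p≤q) fq<t))))))

monotone-content-unique : ∀ {n β} {f g : Fin n → Fin (length β)} → Monotone f → Monotone g → Content β f → Content β g →
  ∀ p → f p ≡ g p
monotone-content-unique {β = β} {f} {g} mf mg cf cg p = Fin.≤-antisym (half mf mg cf cg) (half mg mf cg cf)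
  where
  half : ∀ {f g} → Monotone f → Monotone g → Content β f → Content β g → f p Fin.≤ g p
  half {f} {g} mf mg cf cg = s≤s⁻¹ (monotone-content⁻ {β = β} {f} mf cf (Fin.toℕ<n (g p))
    (monotone-content⁺ {β = β} {g} mg cg (Fin.toℕ<n (g p)) (ℕ.n<1+n (toℕ (g p)))))

block : List ℕ → ℕ → ℕ
-- Placeholder for positions at or beyond the sum of the parts.
block []      p = 0
block (b ∷ β) p with p <? b
... | yes _ = 0
... | no  _ = suc (block β (p ∸ b))

block-<⁺ : ∀ β {p t} → t ≤ length β → block β p < t → p < psum β t
block-<⁺ (b ∷ β) {p} {suc t} (s≤s t≤) lt with p <? b
... | yes p<b = ℕ.<-≤-trans p<b (ℕ.m≤m+n b _)
... | no p≮b = subst (_< b + psum β t) (ℕ.m+[n∸m]≡n (ℕ.≮⇒≥ p≮b)) (ℕ.+-monoʳ-< b (block-<⁺ β t≤ (s≤s⁻¹ lt)))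

block-<⁻ : ∀ β {p t} → t ≤ length β → p < psum β t → block β p < t
block-<⁻ (b ∷ β) {p} {suc t} (s≤s t≤) lt with p <? b
... | yes p<b = s≤s z≤n
... | no p≮b = s≤s (block-<⁻ β t≤ (ℕ.+-cancelˡ-< b _ _ (subst (_< b + psum β t) (sym (ℕ.m+[n∸m]≡n (ℕ.≮⇒≥ p≮b))) lt)))

module _ {n} β (Σβ : sum β ≡ n) where

  private
    block-bound : ∀ (p : Fin n) → block β (toℕ p) < length β
    block-bound p = block-<⁻ β ℕ.≤-refl (subst (toℕ p <_) (sym (trans (psum-length β) Σβ)) (Fin.toℕ<n p))

  blockFin : Fin n → Fin (length β)
  blockFin p = Fin.fromℕ< (block-bound p)

  toℕ-blockFin : ∀ p → toℕ (blockFin p) ≡ block β (toℕ p)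
  toℕ-blockFin p = Fin.toℕ-fromℕ< (block-bound p)

  blockFin-monotone : Monotone blockFin
  blockFin-monotone {i} {j} i≤j = s≤s⁻¹ (subst (_< suc (toℕ (blockFin j))) (sym (toℕ-blockFin i))
    (block-<⁻ β j<k (ℕ.≤-<-trans i≤j (block-<⁺ β j<k (subst (_< suc (toℕ (blockFin j))) (toℕ-blockFin j) (ℕ.n<1+n (toℕ (blockFin j))))))))
    where
    j<k : toℕ (blockFin j) < length β
    j<k = Fin.toℕ<n (blockFin j)

  blockFin-content : Content β blockFin
  blockFin-content t t≤k = trans (ℕ.≤-antisym
      (#-mono (λ p → toℕ (blockFin p) <? t) (λ p → toℕ p <? psum β t)
        (λ {p} lt → block-<⁺ β t≤k (subst (_< t) (toℕ-blockFin p) lt)))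
      (#-mono (λ p → toℕ p <? psum β t) (λ p → toℕ (blockFin p) <? t)
        (λ {p} lt → subst (_< t) (sym (toℕ-blockFin p)) (block-<⁻ β t≤k lt))))
    (#-toℕ< (psum β t) (subst (psum β t ≤_) Σβ (psum-≤ β t)))

-- Sorting by value with a tie-break

-- The tie-break is a parameter because two are needed: increasing labels for all order preserving
-- maps, decreasing labels for strict ones.
module Lex {n k} (f : Fin n → Fin k) {_◁_ : Rel (Fin n) 0ℓ} (sto : IsStrictTotalOrder _≡_ _◁_) where
  open IsStrictTotalOrder sto using (compare) renaming (trans to ◁-trans; irrefl to ◁-irrefl)

  infix 4 _⊏_
  _⊏_ : Rel (Fin n) 0ℓ
  x ⊏ y = f x Fin.< f y ⊎ (f x ≡ f y × x ◁ y)

  ⊏-trans : ∀ {x y z} → x ⊏ y → y ⊏ z → x ⊏ z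
  ⊏-trans (inj₁ p)       (inj₁ q)       = inj₁ (ℕ.<-trans p q)
  ⊏-trans {x} (inj₁ p)   (inj₂ (q , _)) = inj₁ (subst (f x Fin.<_) q p)
  ⊏-trans {z = z} (inj₂ (p , _)) (inj₁ q) = inj₁ (subst (Fin._< f z) (sym p) q)
  ⊏-trans (inj₂ (p , r)) (inj₂ (q , s)) = inj₂ (trans p q , ◁-trans r s)

  ⊏-irrefl : ∀ {x} → ¬ (x ⊏ x)
  ⊏-irrefl (inj₁ p)       = Fin.<-irrefl refl p
  ⊏-irrefl (inj₂ (_ , r)) = ◁-irrefl refl r

  ⊏-isStrictTotalOrder : IsStrictTotalOrder _≡_ _⊏_
  ⊏-isStrictTotalOrder = isStrictTotalOrderᶜ record
    { isEquivalence = Eq.isEquivalence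
    ; trans = ⊏-trans
    ; compare = cmp
    }
    where
    lt : ∀ {x y} → x ⊏ y → Tri (x ⊏ y) (x ≡ y) (y ⊏ x)
    lt p = tri< p (λ { refl → ⊏-irrefl p }) (λ q → ⊏-irrefl (⊏-trans p q))
    gt : ∀ {x y} → y ⊏ x → Tri (x ⊏ y) (x ≡ y) (y ⊏ x)
    gt p = tri> (λ q → ⊏-irrefl (⊏-trans p q)) (λ { refl → ⊏-irrefl p }) p
    cmp : ∀ x y → Tri (x ⊏ y) (x ≡ y) (y ⊏ x)
    cmp x y with Fin.<-cmp (f x) (f y)
    ... | tri< p _ _ = lt (inj₁ p)
    ... | tri> _ _ p = gt (inj₁ p)
    ... | tri≈ _ p _ with compare x y
    ... | tri< q _ _ = lt (inj₂ (p , q))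
    ... | tri> _ _ q = gt (inj₂ (sym p , q))
    ... | tri≈ _ refl _ = tri≈ ⊏-irrefl refl ⊏-irrefl

  ⊏⇒≤ : ∀ {x y} → x ⊏ y → f x Fin.≤ f y
  ⊏⇒≤ (inj₁ p)       = ℕ.<⇒≤ p
  ⊏⇒≤ (inj₂ (p , _)) = ℕ.≤-reflexive (cong toℕ p)

enumerates⇒monotone : ∀ {n k} (f : Fin n → Fin k) {_◁_ : Rel (Fin n) 0ℓ} (sto : IsStrictTotalOrder _≡_ _◁_) (w : Fin n → Fin n) →
  (∀ {i j} → i Fin.< j → Lex._⊏_ f sto (w i) (w j)) → Monotone (f ∘ w)
enumerates⇒monotone f sto w enum i≤j with ℕ.m≤n⇒m<n∨m≡n i≤j
... | inj₁ i<j = Lex.⊏⇒≤ f sto (enum i<j)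
... | inj₂ i≡j = ℕ.≤-reflexive (cong (toℕ ∘ f ∘ w) (Fin.toℕ-injective i≡j))

-- Comparisons inside a fibre of a monotone map follow from those of neighbours.
fibre-chain : ∀ {n k} {f : Fin n → Fin k} → Monotone f → {_◁_ : Rel (Fin n) 0ℓ} → (∀ {x y z} → x ◁ y → y ◁ z → x ◁ z) →
  (∀ {p q} → toℕ q ≡ suc (toℕ p) → f p ≡ f q → p ◁ q) →
  ∀ {i j} → i Fin.< j → f i ≡ f j → i ◁ j
fibre-chain {n} {k} {f} mono {_◁_} ◁-trans adjacent {i} {j} i<j = go _ (sym (ℕ.m∸n+n≡m i<j))
  where
  go : ∀ d {j} → toℕ j ≡ d + suc (toℕ i) → f i ≡ f j → i ◁ j
  go zero    eq fi≡fj = adjacent eq fi≡fj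
  go (suc d) {j} eq fi≡fj = ◁-trans (go d toℕ-q fi≡fq) (adjacent (trans eq (cong suc (sym toℕ-q))) (trans (sym fi≡fq) fi≡fj))
    where
    q<n : d + suc (toℕ i) < n
    q<n = ℕ.<-trans (subst (d + suc (toℕ i) <_) (sym eq) (ℕ.n<1+n _)) (Fin.toℕ<n j)
    q : Fin n
    q = Fin.fromℕ< q<n
    toℕ-q : toℕ q ≡ d + suc (toℕ i)
    toℕ-q = Fin.toℕ-fromℕ< q<n
    i≤q : i Fin.≤ q
    i≤q = subst (toℕ i ≤_) (sym toℕ-q) (ℕ.≤-trans (ℕ.n≤1+n _) (ℕ.m≤n+m _ d))
    q≤j : q Fin.≤ j
    q≤j = subst₂ _≤_ (sym toℕ-q) (sym eq) (ℕ.n≤1+n _)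
    fi≡fq : f i ≡ f q
    fi≡fq = Fin.≤-antisym (mono i≤q) (subst (f q Fin.≤_) (sym fi≡fj) (mono q≤j))

module _ {A B : Set} where

  Unique-concatMap : {f : A → List B} → (∀ x → Unique (f x)) → (∀ {x x′ y} → y ∈ f x → y ∈ f x′ → x ≡ x′) →
    ∀ {xs} → Unique xs → Unique (concatMap f xs)
  Unique-concatMap {f} uniq inj {xs} u = Unique.concat⁺ (All.map⁺ (All.universal uniq xs))
    (AllPairs.map⁺ (AllPairs.map (λ { x≢x′ (y∈ , y∈′) → x≢x′ (inj y∈ y∈′) }) u))

allMaps-unique : ∀ k n → Unique (allMaps k n)
allMaps-unique k zero    = [] ∷ []
allMaps-unique k (suc n) = Unique-concatMap
  (λ v → Unique.map⁺ Vec.∷-injectiveˡ (Unique.allFin⁺ k))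
  (λ {v} {v′} y∈ y∈′ → Vec.∷-injectiveʳ (trans (sym (proj₂ (proj₂ (∈.∈-map⁻ (Vec._∷ v) y∈)))) (proj₂ (proj₂ (∈.∈-map⁻ (Vec._∷ v′) y∈′)))))
  (allMaps-unique k n)

∈-allMaps : ∀ {k n} (v : Vec (Fin k) n) → v ∈ allMaps k n
∈-allMaps []      = here refl
∈-allMaps {k} (x ∷ v) = ∈-concatMap (λ v → map (Vec._∷ v) (allFin k)) (∈-allMaps v) (∈.∈-map⁺ (Vec._∷ v) (∈.∈-allFin x))

lookup-ext : ∀ {A : Set} {n} {u v : Vec A n} → (∀ i → lookup u i ≡ lookup v i) → u ≡ v
lookup-ext {u = u} {v} h = trans (sym (Vec.tabulate∘lookup u)) (trans (Vec.tabulate-cong h) (Vec.tabulate∘lookup v))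

-- Descents, linear extensions and the coefficients of `K_P`

-- Here `i` is the index from 0 of the right-hand entry, which is the position from 1 of the
-- descent, the convention of `D`.
Descent : ∀ {n} → (Fin n → Fin n) → ℕ → Set
Descent {n} w i = ∃[ p ] ∃[ q ] (toℕ q ≡ i × toℕ q ≡ suc (toℕ p) × w q Fin.< w p)

descent? : ∀ {n} (w : Fin n → Fin n) i → Dec (Descent w i)
descent? w i = Fin.any? λ p → Fin.any? λ q → (toℕ q ≟ i) ×-dec (toℕ q ≟ suc (toℕ p)) ×-dec (w q Fin.<? w p)

descentComposition : ∀ {n} → (Fin n → Fin n) → List ℕ
descentComposition {n} w = composition (λ i → does (descent? w i)) n

0∉D-composition : ∀ d n → 0 ∉ D (composition d n)
0∉D-composition d (suc n) = 0∉D (composition-headed d n)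

module _ {n} (w : Fin n → Fin n) where

  D-descentComposition⁻ : ∀ {i} → i ∈ D (descentComposition w) → Descent w i
  D-descentComposition⁻ {zero} 0∈ = contradiction 0∈ (0∉D-composition _ n)
  D-descentComposition⁻ {suc i} i∈ = toWitness {a? = descent? w (suc i)}
    (subst T (sym (isYes≗does (descent? w (suc i)))) (proj₂ (D-composition⁻ _ n i∈)))

  D-descentComposition⁺ : ∀ {p q} → toℕ q ≡ suc (toℕ p) → w q Fin.< w p → toℕ q ∈ D (descentComposition w)
  D-descentComposition⁺ {p} {q} eq lt = subst (_∈ D (descentComposition w)) (sym eq)
    (D-composition⁺ _ n (subst (_< n) eq (Fin.toℕ<n q))
      (subst T (sym (dec-true (descent? w (suc (toℕ p))) (p , q , eq , eq , lt))) tt))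

module _ {n} (P : NatLabeledPoset n) where

  infix 4 _≤ₚ_ _<ₚ_
  _≤ₚ_ _<ₚ_ : Rel (Fin n) 0ℓ
  x ≤ₚ y = T (_≼_ P x y)
  x <ₚ y = x ≤ₚ y × x ≢ y

module _ {n} (P : NatLabeledPoset n) where

  private
    infix 4 _≤P_
    _≤P_ = _≤ₚ_ P

  <ₚ⇒< : ∀ {x y} → _<ₚ_ P x y → x Fin.< y
  <ₚ⇒< {x} {y} (x≤y , x≢y) = ℕ.≤∧≢⇒< (natural P x y x≤y) (x≢y ∘ Fin.toℕ-injective)

  OrderPreserving : ∀ {k} → (Fin n → Fin k) → Set
  OrderPreserving σ = ∀ {x y} → x ≤P y → σ x Fin.≤ σ y

  Strict : ∀ {k} → (Fin n → Fin k) → Set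
  Strict σ = ∀ {x y} → _<ₚ_ P x y → σ x Fin.< σ y

  -- Words list the labels by position; by reflexivity of ≤ the condition makes them injective.
  LinearExtension : (Fin n → Fin n) → Set
  LinearExtension w = ∀ i j → w i ≤P w j → i Fin.≤ j

  linearExtension? : ∀ w → Dec (LinearExtension w)
  linearExtension? w = Fin.all? λ i → Fin.all? λ j → T? (_≼_ P (w i) (w j)) →-dec (i Fin.≤? j)

  linearExtension-injective : ∀ {w} → LinearExtension w → Injective _≡_ _≡_ w
  linearExtension-injective {w} lin {i} {j} eq = Fin.≤-antisym
    (lin i j (subst (w i ≤P_) eq (≼-refl P (w i)))) (lin j i (subst (_≤P w i) eq (≼-refl P (w i))))

  linearExtensions : List (Vec (Fin n) n)
  linearExtensions = filter (linearExtension? ∘ lookup) (allMaps n n)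

  orderPreservingᵇ⇒ : ∀ {k} (σ : Vec (Fin k) n) → T (orderPreservingᵇ P σ) → OrderPreserving (lookup σ)
  orderPreservingᵇ⇒ σ h {x} {y} x≤y with _≼_ P x y | x≤y | T-all⁻ _ (allFin n) (T-all⁻ _ (allFin n) h (∈.∈-allFin x)) (∈.∈-allFin y)
  ... | true | _ | t = ℕ.≤ᵇ⇒≤ _ _ t

  ⇒orderPreservingᵇ : ∀ {k} (σ : Vec (Fin k) n) → OrderPreserving (lookup σ) → T (orderPreservingᵇ P σ)
  ⇒orderPreservingᵇ σ h = T-all⁺ _ (allFin n) λ {x} _ → T-all⁺ _ (allFin n) λ {y} _ → clause x y
    where
    clause : ∀ x y → T (not (_≼_ P x y) ∨ (toℕ (lookup σ x) ≤ᵇ toℕ (lookup σ y)))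
    clause x y with _≼_ P x y | h {x} {y}
    ... | true  | mono = ℕ.≤⇒≤ᵇ (mono tt)
    ... | false | _    = tt

  -- Values cannot put a larger element first, so only ties matter. The condition on ties holds for
  -- increasing labels because the labeling is natural, and for decreasing labels because a strict
  -- map has no ties between comparable elements.
  sorted⇒linearExtension : ∀ {k} {f : Fin n → Fin k} {_◁_ : Rel (Fin n) 0ℓ} (sto : IsStrictTotalOrder _≡_ _◁_) →
    OrderPreserving f → (∀ {x y} → _<ₚ_ P x y → f x ≡ f y → ¬ (y ◁ x)) →
    (w : Permutation′ n) → Enumerates (Lex.⊏-isStrictTotalOrder f sto) w → LinearExtension (w ⟨$⟩ʳ_)
  sorted⇒linearExtension {f = f} sto mono ¬◁ w enum i j wi≤wj with i Fin.≤? j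
  ... | yes i≤j = i≤j
  ... | no i≰j with enum (ℕ.≰⇒> i≰j)
  ... | inj₁ lt        = contradiction (mono wi≤wj) (ℕ.<⇒≱ lt)
  ... | inj₂ (eq , lt) = contradiction lt (¬◁ (wi≤wj , λ wi≡wj → i≰j (ℕ.≤-reflexive (cong toℕ (⟨$⟩ʳ-injective w wi≡wj)))) (sym eq))

  -- The fundamental lemma of P-partitions: sorting by (value, label) matches the P-partitions of content β
  -- with the linear extensions whose descents lie in D β.
  module _ {β} (β∈ : β ∈ compositions n) where

    private
      k = length β

      P-partition? : (σ : Vec (Fin k) n) → Dec (T (orderPreservingᵇ P σ ∧ hasFibersᵇ β σ))
      P-partition? σ = T? _

      coarse? : (w : Vec (Fin n) n) → Dec (T (subsetᵇ (D (descentComposition (lookup w))) (D β)))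
      coarse? w = T? _

      P-partitions : List (Vec (Fin k) n)
      P-partitions = filter P-partition? (allMaps k n)

      words : List (Vec (Fin n) n)
      words = filter coarse? linearExtensions

      module _ (σ : Vec (Fin k) n) where
        open Lex (lookup σ) (Fin.<-isStrictTotalOrder {n}) public using (_⊏_) renaming (⊏-isStrictTotalOrder to ⊏-sto)

      -- The graph of the bijection between P-partitions and words, kept as a relation so that
      -- `length-≤` applies to it in both directions.
      record Sorts (w : Vec (Fin n) n) (σ : Vec (Fin k) n) : Set where
        field
          linear  : LinearExtension (lookup w)
          content : Content β (lookup σ)
          sorted  : ∀ {i j} → i Fin.< j → _⊏_ σ (lookup w i) (lookup w j)

        permutationOf : Σ (Permutation′ n) λ π → ∀ x → π ⟨$⟩ʳ x ≡ lookup w x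
        permutationOf = injective⇒permutation (lookup w) (linearExtension-injective linear)

        word : Permutation′ n
        word = proj₁ permutationOf

        word≗ : ∀ x → word ⟨$⟩ʳ x ≡ lookup w x
        word≗ = proj₂ permutationOf

        enumerates : Enumerates (⊏-sto σ) word
        enumerates i<j = subst₂ (_⊏_ σ) (sym (word≗ _)) (sym (word≗ _)) (sorted i<j)

        monotone : Monotone (lookup σ ∘ lookup w)
        monotone = enumerates⇒monotone (lookup σ) (Fin.<-isStrictTotalOrder {n}) (lookup w) sorted

        word-content : Content β (lookup σ ∘ lookup w)
        word-content = Content-∘ β word (λ x → cong (lookup σ) (sym (word≗ x))) content

        surjective : ∀ x → lookup w (word ⟨$⟩ˡ x) ≡ x
        surjective x = trans (sym (word≗ _)) (inverseʳ word)

      -- Read along `w`, both maps are monotone with the same content, hence equal at every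
      -- position; and `w` reaches every element.
      sorts-functional : ∀ {w σ σ′} → Sorts w σ → Sorts w σ′ → σ ≡ σ′
      sorts-functional {w} {σ} {σ′} s s′ = lookup-ext λ x →
        subst (λ z → lookup σ z ≡ lookup σ′ z) (surjective s x)
          (monotone-content-unique {β = β} (monotone s) (monotone s′) (word-content s) (word-content s′) (word s ⟨$⟩ˡ x))
        where open Sorts

      sorts-injective : ∀ {w w′ σ} → Sorts w σ → Sorts w′ σ → w ≡ w′
      sorts-injective {σ = σ} s s′ = lookup-ext λ i → trans (sym (word≗ s i))
        (trans (enumeration-unique (⊏-sto σ) (word s) (word s′) (enumerates s) (enumerates s′) i) (word≗ s′ i))
        where open Sorts

      -- At a descent of `w` the value of `σ` must rise, since a tie would be sorted by increasing
      -- label. A rise happens at the end of a block, and block ends are partial sums of `β`.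
      descents-coarse : ∀ {w σ} → Sorts w σ → D (descentComposition (lookup w)) ⊑ D β
      descents-coarse {w} {σ} s i∈ with D-descentComposition⁻ (lookup w) i∈
      ... | p , q , refl , q≡1+p , wq<wp with Sorts.sorted s {p} {q} (ℕ.≤-reflexive (sym q≡1+p))
      ... | inj₂ (_ , wp<wq) = contradiction wp<wq (ℕ.<-asym wq<wp)
      ... | inj₁ σp<σq = subst (_∈ D β) psum≡q (psum-∈-D β (toℕ σp) (ℕ.≤-<-trans σp<σq (Fin.toℕ<n σq)))
        where
        σp σq : Fin k
        σp = lookup σ (lookup w p)
        σq = lookup σ (lookup w q)
        p<psum : toℕ p < psum β (suc (toℕ σp))
        p<psum = monotone-content⁺ {β = β} {lookup σ ∘ lookup w} (Sorts.monotone s) (Sorts.word-content s) {p} (Fin.toℕ<n σp) (ℕ.n<1+n _)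
        q≮psum : ¬ (toℕ q < psum β (suc (toℕ σp)))
        q≮psum lt = ℕ.<⇒≱ (monotone-content⁻ {β = β} {lookup σ ∘ lookup w} (Sorts.monotone s) (Sorts.word-content s) {q} (Fin.toℕ<n σp) lt) σp<σq
        psum≡q : psum β (suc (toℕ σp)) ≡ toℕ q
        psum≡q = ℕ.≤-antisym (ℕ.≮⇒≥ q≮psum) (subst (_≤ psum β (suc (toℕ σp))) (sym q≡1+p) p<psum)

      P-partition⁻ : ∀ {σ} → σ ∈ P-partitions → OrderPreserving (lookup σ) × Content β (lookup σ)
      P-partition⁻ {σ} σ∈ with Equivalence.to Bool.T-∧ (proj₂ (∈.∈-filter⁻ P-partition? {xs = allMaps k n} σ∈))
      ... | op , fibers = orderPreservingᵇ⇒ σ op , hasFibers⇒Content β σ fibers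

      sort-partition : ∀ {σ} → σ ∈ P-partitions → ∃ λ w → w ∈ words × Sorts w σ
      sort-partition {σ} σ∈ with P-partition⁻ σ∈ | enumeration (⊏-sto σ)
      ... | op , content | π , enum = w
          , ∈.∈-filter⁺ coarse? (∈.∈-filter⁺ (linearExtension? ∘ lookup) (∈-allMaps w) (Sorts.linear sorts)) (⊑⇒subsetᵇ (D (descentComposition (lookup w))) (D β) (descents-coarse sorts))
          , sorts
        where
        w : Vec (Fin n) n
        w = tabulate (π ⟨$⟩ʳ_)
        w≗ : ∀ i → π ⟨$⟩ʳ i ≡ lookup w i
        w≗ i = sym (Vec.lookup∘tabulate (π ⟨$⟩ʳ_) i)
        lin : LinearExtension (π ⟨$⟩ʳ_)
        lin = sorted⇒linearExtension {f = lookup σ} (Fin.<-isStrictTotalOrder {n}) op (λ x<y _ y<x → ℕ.<-asym (<ₚ⇒< x<y) y<x) π enum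
        sorts : Sorts w σ
        sorts = record
          { linear  = λ i j wi≤wj → lin i j (subst₂ _≤P_ (sym (w≗ i)) (sym (w≗ j)) wi≤wj)
          ; content = content
          ; sorted  = λ i<j → subst₂ (_⊏_ σ) (w≗ _) (w≗ _) (enum i<j)
          }

      words⁻ : ∀ {w} → w ∈ words → LinearExtension (lookup w) × D (descentComposition (lookup w)) ⊑ D β
      words⁻ {w} w∈ with ∈.∈-filter⁻ coarse? {xs = linearExtensions} w∈
      ... | w∈′ , coarse = proj₂ (∈.∈-filter⁻ (linearExtension? ∘ lookup) {xs = allMaps n n} w∈′) , subsetᵇ⇒⊑ (D (descentComposition (lookup w))) (D β) coarse

      -- The inverse construction: cut the word into consecutive blocks of lengths `β` and send each
      -- letter to the index of its block.
      fill-word : ∀ {w} → w ∈ words → ∃ λ σ → σ ∈ P-partitions × Sorts w σ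
      fill-word {w} w∈ with words⁻ w∈
      ... | lin , coarse = σ
          , ∈.∈-filter⁺ P-partition? (∈-allMaps σ) (Equivalence.from Bool.T-∧ (⇒orderPreservingᵇ σ op , Content⇒hasFibers β σ content))
          , record { linear = lin ; content = content ; sorted = sorted }
        where
        Σβ : sum β ≡ n
        Σβ = All.lookup (sum-compositions n) β∈
        f : Fin n → Fin k
        f = blockFin β Σβ
        f-mono : Monotone f
        f-mono = blockFin-monotone β Σβ
        f-content : Content β f
        f-content = blockFin-content β Σβ
        w-perm = injective⇒permutation (lookup w) (linearExtension-injective lin)
        π : Permutation′ n
        π = proj₁ w-perm
        σ : Vec (Fin k) n
        σ = tabulate (λ x → f (π ⟨$⟩ˡ x))
        σ≗ : ∀ x → lookup σ x ≡ f (π ⟨$⟩ˡ x)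
        σ≗ = Vec.lookup∘tabulate (λ x → f (π ⟨$⟩ˡ x))
        w-π : ∀ x → lookup w (π ⟨$⟩ˡ x) ≡ x
        w-π x = trans (sym (proj₂ w-perm _)) (inverseʳ π)
        σw≗f : ∀ i → lookup σ (lookup w i) ≡ f i
        σw≗f i = trans (σ≗ _) (cong f (trans (cong (π ⟨$⟩ˡ_) (sym (proj₂ w-perm i))) (inverseˡ π)))
        content : Content β (lookup σ)
        content = Content-∘ β (flip π) σ≗ f-content
        op : OrderPreserving (lookup σ)
        op {x} {y} x≤y = subst₂ Fin._≤_ (sym (σ≗ x)) (sym (σ≗ y))
          (f-mono (lin _ _ (subst₂ _≤P_ (sym (w-π x)) (sym (w-π y)) x≤y)))
        adjacent : ∀ {p q} → toℕ q ≡ suc (toℕ p) → f p ≡ f q → lookup w p Fin.< lookup w q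
        adjacent {p} {q} q≡1+p fp≡fq with Fin.<-cmp (lookup w p) (lookup w q)
        ... | tri< lt _ _ = lt
        ... | tri≈ _ eq _ = contradiction (trans q≡1+p (cong (suc ∘ toℕ) (linearExtension-injective lin eq))) (ℕ.<⇒≢ (ℕ.n<1+n _))
        -- A descent here would make `q` a partial sum of `β`, so a block would end between `p` and
        -- `q`, which share a block.
        ... | tri> _ _ gt with D-psum β (coarse (D-descentComposition⁺ (lookup w) q≡1+p gt))
        ... | t , t≤k , q≡psum = contradiction
          (monotone-content⁺ {β = β} f-mono f-content t≤k (subst (λ z → toℕ z < t) fp≡fq
            (monotone-content⁻ {β = β} f-mono f-content {p} t≤k (subst (toℕ p <_) q≡psum (ℕ.≤-reflexive (sym q≡1+p))))))
          (ℕ.<-irrefl q≡psum)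
        sorted : ∀ {i j} → i Fin.< j → _⊏_ σ (lookup w i) (lookup w j)
        sorted {i} {j} i<j with Fin.<-cmp (f i) (f j)
        ... | tri< lt _ _ = inj₁ (subst₂ Fin._<_ (sym (σw≗f i)) (sym (σw≗f j)) lt)
        ... | tri≈ _ eq _ = inj₂ (trans (σw≗f i) (trans eq (sym (σw≗f j)))
            , fibre-chain f-mono {λ p q → lookup w p Fin.< lookup w q} ℕ.<-trans adjacent i<j eq)
        ... | tri> _ _ gt = contradiction (f-mono (ℕ.<⇒≤ i<j)) (ℕ.<⇒≱ gt)

    monomialCoeff-words : monomialCoeff P β ≡
      length (filterᵇ (λ w → subsetᵇ (D (descentComposition (lookup w))) (D β)) linearExtensions)
    monomialCoeff-words = ℕ.≤-antisym
      (length-≤ (λ σ w → Sorts w σ) (Unique.filter⁺ P-partition? (allMaps-unique k n)) sort-partition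
        (λ _ _ → sorts-functional))
      (length-≤ Sorts (Unique.filter⁺ coarse? (Unique.filter⁺ (linearExtension? ∘ lookup) (allMaps-unique n n))) fill-word
        (λ _ _ → sorts-injective))

  descentCount : List ℕ → ℕ
  descentCount α = length (filter (λ w → descentComposition (lookup w) ≟ˡ α) linearExtensions)

  module _ {c : List ℕ → ℤ} (expansion : IsLExpansion P c) where

    -- The monomial coefficients count the linear extensions with descent set inside `D β`; grouped
    -- by descent composition they form an `LSum`, and `LSum-injective` compares coefficients. As
    -- these are counts, nothing cancels, so the support consists exactly of the descent
    -- compositions that occur.
    LExpansion-coefficient : ∀ {α} → α ∈ compositions n → c α ≡ ℤ+ descentCount α
    LExpansion-coefficient = LSum-injective n c (λ α → ℤ+ descentCount α) λ {β} β∈ →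
      trans (sym (expansion β β∈)) (trans (cong ℤ+_ (monomialCoeff-words β∈))
        (length-filter-key (descentComposition ∘ lookup) (λ α → subsetᵇ (D α) (D β)) (compositions-unique n)
          (λ w → composition-∈ _ n) linearExtensions))

    LinearExtension⇒InSupp : ∀ w → LinearExtension (lookup w) → InSupp n c (descentComposition (lookup w))
    LinearExtension⇒InSupp w lin = composition-∈ _ n , λ c≡0 → nonempty
        (ℤ.+-injective (trans (sym (LExpansion-coefficient (composition-∈ _ n))) c≡0))
        (∈.∈-filter⁺ (λ v → descentComposition (lookup v) ≟ˡ descentComposition (lookup w))
          (∈.∈-filter⁺ (linearExtension? ∘ lookup) (∈-allMaps w) lin) refl)
      where
      nonempty : {A : Set} {xs : List A} → length xs ≡ 0 → ∀ {x} → x ∈ xs → ⊥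
      nonempty {xs = []} _ ()

    InSupp⇒LinearExtension : ∀ {α} → InSupp n c α → ∃ λ w → LinearExtension w × descentComposition w ≡ α
    InSupp⇒LinearExtension {α} (α∈ , c≢0) with filter (λ w → descentComposition (lookup w) ≟ˡ α) linearExtensions in eq
    ... | [] = contradiction (trans (LExpansion-coefficient α∈) (cong (ℤ+_ ∘ length) eq)) c≢0
    ... | w ∷ _ with ∈.∈-filter⁻ (λ w → descentComposition (lookup w) ≟ˡ α) {xs = linearExtensions} (subst (w ∈_) (sym eq) (here refl))
    ... | w∈ , refl = lookup w , proj₂ (∈.∈-filter⁻ (linearExtension? ∘ lookup) {xs = allMaps n n} w∈) , refl

-- Transfer of strict maps from one poset to another

-- One-sided and without multiplicities: precisely what an inclusion of supports provides.
SameDescents : ∀ {n} → NatLabeledPoset n → NatLabeledPoset n → Set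
SameDescents {n} P Q = ∀ (w : Vec (Fin n) n) → LinearExtension P (lookup w) →
  ∃ λ w′ → LinearExtension Q w′ × descentComposition w′ ≡ descentComposition (lookup w)

module _ {n} (P : NatLabeledPoset n) where

  <ₚ-≤ₚ-trans : ∀ {x y z} → _<ₚ_ P x y → _≤ₚ_ P y z → _<ₚ_ P x z
  <ₚ-≤ₚ-trans {x} {y} {z} (x≤y , x≢y) y≤z = ≼-trans P x y z x≤y y≤z ,
    λ { refl → x≢y (≼-antisym P x y x≤y y≤z) }

  ≤ₚ-<ₚ-trans : ∀ {x y z} → _≤ₚ_ P x y → _<ₚ_ P y z → _<ₚ_ P x z
  ≤ₚ-<ₚ-trans {x} {y} {z} x≤y (y≤z , y≢z) = ≼-trans P x y z x≤y y≤z ,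
    λ { refl → y≢z (≼-antisym P y z y≤z x≤y) }

  _<ₚ?_ : ∀ x y → Dec (_<ₚ_ P x y)
  x <ₚ? y = T? (_≼_ P x y) ×-dec ¬? (x Fin.≟ y)

  strict⇒orderPreserving : ∀ {k} {σ : Fin n → Fin k} → Strict P σ → OrderPreserving P σ
  strict⇒orderPreserving {σ = σ} strict {x} {y} x≤y with x Fin.≟ y
  ... | yes refl = ℕ.≤-refl
  ... | no x≢y   = ℕ.<⇒≤ (strict (x≤y , x≢y))

-- If `x` lies below `y` in `Q`, it precedes `y` in the word. Were both in one block, the descents
-- throughout the block would give `x` the larger label, against natural labeling.
cut-strict : ∀ {n} {Q : NatLabeledPoset n} {v : Fin n → Fin n} → LinearExtension Q v →
  (w : Permutation′ n) → (∀ i → w ⟨$⟩ʳ i ≡ v i) → ∀ {k} {b : Fin n → Fin k} → Monotone b →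
  (∀ {p q} → toℕ q ≡ suc (toℕ p) → b p ≡ b q → v q Fin.< v p) →
  Strict Q (λ y → b (w ⟨$⟩ˡ y))
cut-strict {n} {Q} {v} v-linear w w≗v {k} {b} b-mono adjacent {x} {y} x<y@(x≤y , x≢y) with Fin.<-cmp (b (w ⟨$⟩ˡ x)) (b (w ⟨$⟩ˡ y))
... | tri< lt _ _ = lt
... | tri> _ _ gt = contradiction (b-mono i≤j) (ℕ.<⇒≱ gt)
  where
  i≤j : w ⟨$⟩ˡ x Fin.≤ w ⟨$⟩ˡ y
  i≤j = v-linear _ _ (subst₂ (_≤ₚ_ Q) (trans (sym (inverseʳ w)) (w≗v _)) (trans (sym (inverseʳ w)) (w≗v _)) x≤y)
... | tri≈ _ eq _ = contradiction (<ₚ⇒< Q x<y) (ℕ.<-asym (subst₂ Fin._<_ (trans (sym (w≗v _)) (inverseʳ w)) (trans (sym (w≗v _)) (inverseʳ w))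
    (fibre-chain b-mono {λ p q → v q Fin.< v p} (λ p q → ℕ.<-trans q p) adjacent i<j eq)))
  where
  i<j : w ⟨$⟩ˡ x Fin.< w ⟨$⟩ˡ y
  i<j = ℕ.≤∧≢⇒< (v-linear _ _ (subst₂ (_≤ₚ_ Q) (trans (sym (inverseʳ w)) (w≗v _)) (trans (sym (inverseʳ w)) (w≗v _)) x≤y))
    (λ e → x≢y (⟨$⟩ʳ-injective (flip w) (Fin.toℕ-injective e)))

same-descents : ∀ {n} (u v : Fin n → Fin n) → descentComposition v ≡ descentComposition u →
  ∀ {p q} → toℕ q ≡ suc (toℕ p) → u q Fin.< u p → v q Fin.< v p
same-descents u v eq {p} {q} q≡1+p lt with D-descentComposition⁻ v (subst (λ α → toℕ q ∈ D α) (sym eq) (D-descentComposition⁺ u q≡1+p lt))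
... | p′ , q′ , q′≡q , q′≡1+p′ , lt′ = subst₂ (λ x y → v x Fin.< v y) (Fin.toℕ-injective q′≡q)
  (Fin.toℕ-injective (ℕ.suc-injective (trans (sym q′≡1+p′) (trans q′≡q q≡1+p)))) lt′

>-isStrictTotalOrder : ∀ {n} → IsStrictTotalOrder _≡_ (λ (x y : Fin n) → y Fin.< x)
>-isStrictTotalOrder = Flip.isStrictTotalOrder Fin.<-isStrictTotalOrder

-- Listing each fibre of a strict map by decreasing labels puts a descent between neighbours of the same fibre;
-- a linear extension of Q with these descents can be cut into the same blocks, and they are antichains of Q.
abstract
  transfer : ∀ {n} {P Q : NatLabeledPoset n} → SameDescents P Q → ∀ {k} {σ : Fin n → Fin k} → Strict P σ →
    ∃[ σ′ ] ∃[ π ] (Strict {n} Q {k} σ′ × ∀ x → σ′ (π ⟨$⟩ʳ x) ≡ σ x)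
  transfer {n} {P} {Q} same {k} {σ} strict with enumeration (Lex.⊏-isStrictTotalOrder σ >-isStrictTotalOrder)
  ... | τ , enum with same (tabulate (τ ⟨$⟩ʳ_)) τ-linear
    where
    τ-linear : LinearExtension P (lookup (tabulate (τ ⟨$⟩ʳ_)))
    τ-linear i j h = sorted⇒linearExtension P {f = σ} >-isStrictTotalOrder (strict⇒orderPreserving P strict)
      (λ x<y σx≡σy _ → Fin.<-irrefl σx≡σy (strict x<y)) τ enum i j
      (subst₂ (_≤ₚ_ P) (Vec.lookup∘tabulate (τ ⟨$⟩ʳ_) i) (Vec.lookup∘tabulate (τ ⟨$⟩ʳ_) j) h)
  ... | v , v-linear , v-descents with injective⇒permutation v (linearExtension-injective Q v-linear)
  ... | w , w≗v = (λ y → σ (τ ⟨$⟩ʳ (w ⟨$⟩ˡ y))) , flip τ ∘ₚ w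
      , (λ {x} {y} → cut-strict {Q = Q} v-linear w w≗v (enumerates⇒monotone σ >-isStrictTotalOrder (τ ⟨$⟩ʳ_) enum) adjacent {x} {y})
      , (λ x → cong σ (trans (cong (τ ⟨$⟩ʳ_) (inverseˡ w)) (inverseʳ τ)))
    where
    adjacent : ∀ {p q} → toℕ q ≡ suc (toℕ p) → σ (τ ⟨$⟩ʳ p) ≡ σ (τ ⟨$⟩ʳ q) → v q Fin.< v p
    adjacent {p} {q} q≡1+p eq with enum {p} {q} (ℕ.≤-reflexive (sym q≡1+p))
    ... | inj₁ lt       = contradiction lt (Fin.<-irrefl eq)
    ... | inj₂ (_ , gt) = same-descents (lookup (tabulate (τ ⟨$⟩ʳ_))) v v-descents q≡1+p
      (subst₂ Fin._<_ (sym (Vec.lookup∘tabulate (τ ⟨$⟩ʳ_) q)) (sym (Vec.lookup∘tabulate (τ ⟨$⟩ʳ_) p)) gt)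

-- Longest chains

greatest : {Q : ℕ → Set} → (∀ k → Dec (Q k)) → Q 0 → ∀ N → (∀ {k} → Q k → k ≤ N) →
  ∃[ m ] (Q m × ∀ {k} → Q k → k ≤ m)
greatest Q? q₀ zero    bound = 0 , q₀ , bound
greatest Q? q₀ (suc N) bound with Q? (suc N)
... | yes q = suc N , q , bound
... | no ¬q = greatest Q? q₀ N (λ {k} q → [ s≤s⁻¹ , (λ { refl → contradiction q ¬q }) ]′ (ℕ.m≤n⇒m<n∨m≡n (bound q)))

-- The strict map `level` certifies maximality: it is injective on every chain, so none exceeds `ℓ`.
-- Unlike a universal statement about chains, such a certificate can be transferred to another
-- poset.
record LongestChain {n} (P : NatLabeledPoset n) (ℓ : ℕ) : Set where
  field
    chain        : Fin ℓ → Fin n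
    chain-mono   : ∀ {i j} → i Fin.< j → _<ₚ_ P (chain i) (chain j)
    level        : Fin n → Fin ℓ
    level-strict : Strict P level

module _ {n} {P : NatLabeledPoset n} {ℓ} (longest : LongestChain P ℓ) where
  open LongestChain longest

  chain-≤ : ∀ {i j} → i Fin.≤ j → _≤ₚ_ P (chain i) (chain j)
  chain-≤ {i} {j} i≤j with ℕ.m≤n⇒m<n∨m≡n i≤j
  ... | inj₁ i<j = proj₁ (chain-mono i<j)
  ... | inj₂ i≡j rewrite Fin.toℕ-injective {i = i} {j} i≡j = ≼-refl P _

  chain-injective : Injective _≡_ _≡_ chain
  chain-injective {i} {j} eq with Fin.<-cmp i j
  ... | tri< lt _ _ = contradiction eq (proj₂ (chain-mono lt))
  ... | tri≈ _ i≡j _ = i≡j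
  ... | tri> _ _ gt = contradiction (sym eq) (proj₂ (chain-mono gt))

-- Mirsky's theorem
longestChain : ∀ {n} (P : NatLabeledPoset n) → ∃ (LongestChain P)
longestChain {n} P = ℓ , record
  { chain        = chain ℓ ℓ-chain
  ; chain-mono   = chain-mono ℓ ℓ-chain
  -- `depth` measures the longest chain strictly above `x`, so it falls along the order and has to
  -- be reversed.
  ; level        = λ x → Fin.opposite (Fin.fromℕ< (depth<ℓ x))
  ; level-strict = level-strict
  }
  where
  infix 4 _<P_
  _<P_ = _<ₚ_ P

  ChainAbove : ℕ → Fin n → Set
  ChainAbove zero    x = T true
  ChainAbove (suc k) x = ∃[ y ] (x <P y × ChainAbove k y)

  chainAbove? : ∀ k x → Dec (ChainAbove k x)
  chainAbove? zero    x = yes tt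
  chainAbove? (suc k) x = Fin.any? λ y → _<ₚ?_ P x y ×-dec chainAbove? k y

  -- Labels rise strictly along a chain, which bounds the search for the longest one.
  chainAbove-bound : ∀ k x → ChainAbove k x → k + toℕ x < n
  chainAbove-bound zero    x _ = Fin.toℕ<n x
  chainAbove-bound (suc k) x (y , x<y , above) = ℕ.≤-<-trans
    (subst (_≤ k + toℕ y) (ℕ.+-suc k (toℕ x)) (ℕ.+-monoʳ-≤ k (<ₚ⇒< P x<y))) (chainAbove-bound k y above)

  ChainOf : ℕ → Set
  ChainOf zero    = T true
  ChainOf (suc k) = ∃ (ChainAbove k)

  chainOf? : ∀ k → Dec (ChainOf k)
  chainOf? zero    = yes tt
  chainOf? (suc k) = Fin.any? (chainAbove? k)

  chainOf-bound : ∀ {k} → ChainOf k → k ≤ n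
  chainOf-bound {zero}  _ = z≤n
  chainOf-bound {suc k} (x , above) = ℕ.≤-trans (s≤s (ℕ.m≤m+n k (toℕ x))) (chainAbove-bound k x above)

  ℓ-max = greatest chainOf? tt n (λ {k} → chainOf-bound {k})
  ℓ = proj₁ ℓ-max
  ℓ-chain = proj₁ (proj₂ ℓ-max)

  depth-max : ∀ x → ∃[ m ] (ChainAbove m x × ∀ {k} → ChainAbove k x → k ≤ m)
  depth-max x = greatest (λ k → chainAbove? k x) tt n
    (λ {k} above → ℕ.<⇒≤ (ℕ.≤-<-trans (ℕ.m≤m+n k (toℕ x)) (chainAbove-bound k x above)))

  depth : Fin n → ℕ
  depth x = proj₁ (depth-max x)

  depth<ℓ : ∀ x → depth x < ℓ
  depth<ℓ x = proj₂ (proj₂ ℓ-max) (x , proj₁ (proj₂ (depth-max x)))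

  depth-strict : ∀ {x y} → x <P y → depth y < depth x
  depth-strict {x} {y} x<y = proj₂ (proj₂ (depth-max x)) (y , x<y , proj₁ (proj₂ (depth-max y)))

  level-strict : Strict P (λ x → Fin.opposite (Fin.fromℕ< (depth<ℓ x)))
  level-strict {x} {y} x<y = subst₂ _<_ (sym (toℕ-level x)) (sym (toℕ-level y))
    (ℕ.∸-monoʳ-< (s≤s (depth-strict x<y)) (depth<ℓ x))
    where
    toℕ-level : ∀ z → toℕ (Fin.opposite (Fin.fromℕ< (depth<ℓ z))) ≡ ℓ ∸ suc (depth z)
    toℕ-level z = trans (Fin.opposite-prop (Fin.fromℕ< (depth<ℓ z))) (cong (λ d → ℓ ∸ suc d) (Fin.toℕ-fromℕ< (depth<ℓ z)))

  chainFrom : ∀ k x → ChainAbove k x → Fin (suc k) → Fin n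
  chainFrom k       x _               zero    = x
  chainFrom (suc k) x (y , _ , above) (suc i) = chainFrom k y above i

  chainFrom-≥ : ∀ k x above i → _≤ₚ_ P x (chainFrom k x above i)
  chainFrom-≥ k       x _                     zero    = ≼-refl P x
  chainFrom-≥ (suc k) x (y , (x≤y , _) , above) (suc i) = ≼-trans P x y _ x≤y (chainFrom-≥ k y above i)

  chainFrom-mono : ∀ k x above {i j} → i Fin.< j → chainFrom k x above i <P chainFrom k x above j
  chainFrom-mono (suc k) x (y , x<y , above) {zero}  {suc j} _         = <ₚ-≤ₚ-trans P x<y (chainFrom-≥ k y above j)
  chainFrom-mono (suc k) x (y , x<y , above) {suc i} {suc j} (s≤s i<j) = chainFrom-mono k y above i<j

  chain : ∀ k → ChainOf k → Fin k → Fin n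
  chain (suc k) (x , above) = chainFrom k x above

  chain-mono : ∀ k (c : ChainOf k) {i j} → i Fin.< j → chain k c i <P chain k c j
  chain-mono (suc k) (x , above) = chainFrom-mono k x above

-- A strict map onto the levels all of whose fibres but the r-th are singletons.
HookMap : ∀ {n} → NatLabeledPoset n → ℕ → Set
HookMap {n} P ℓ = ∃[ r ] ∃[ σ ] (Strict P {ℓ} σ × ∀ x y → σ x ≡ σ y → toℕ (σ x) ≢ r → x ≡ y)

-- Intervals on the longest chain, and strict maps as choices from them

module Interval {n} {P : NatLabeledPoset n} {ℓ} (longest : LongestChain P ℓ) (hook : HookMap P ℓ) where
  open LongestChain longest public

  private
    infix 4 _≤P_ _<P_
    _≤P_ = _≤ₚ_ P
    _<P_ = _<ₚ_ P

  Incomparable : Fin n → Fin ℓ → Set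
  Incomparable x j = ¬ (chain j <P x) × ¬ (x <P chain j)

  incomparable? : ∀ x j → Dec (Incomparable x j)
  incomparable? x j = ¬? (_<ₚ?_ P (chain j) x) ×-dec ¬? (_<ₚ?_ P x (chain j))

  interval : Fin n → Subset ℓ
  interval x = tabulate (λ j → does (incomparable? x j))

  ∈-interval⁺ : ∀ {x j} → Incomparable x j → j Sub.∈ interval x
  ∈-interval⁺ {x} {j} inc = Vec.lookup⇒[]= j (interval x)
    (trans (Vec.lookup∘tabulate _ j) (dec-true (incomparable? x j) inc))

  ∈-interval⁻ : ∀ {x j} → j Sub.∈ interval x → Incomparable x j
  ∈-interval⁻ {x} {j} j∈ = toWitness {a? = incomparable? x j} (subst T (sym (isYes≗does (incomparable? x j)))
    (subst T (trans (sym (Vec.[]=⇒lookup j∈)) (Vec.lookup∘tabulate _ j)) tt))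

  -- A chain of `ℓ` elements leaves a strict map into `ℓ` levels no slack: restricted to it, the map
  -- is a strictly increasing self-map of `Fin ℓ`.
  strict-chain : ∀ {σ} → Strict P σ → ∀ i → σ (chain i) ≡ i
  strict-chain {σ} strict = strictlyMonotone⇒id (σ ∘ chain) (λ i<j → strict (chain-mono i<j))

  -- The element `chain (σ x)` has the same value as `x` under `σ`, so strictness forbids either
  -- order between them.
  strict⇒∈-interval : ∀ {σ} → Strict P σ → ∀ x → σ x Sub.∈ interval x
  strict⇒∈-interval {σ} strict x = ∈-interval⁺
    ( (λ lt → Fin.<-irrefl (strict-chain strict (σ x)) (strict lt))
    , (λ lt → Fin.<-irrefl (sym (strict-chain strict (σ x))) (strict lt)))

  private
    r = proj₁ hook
    ρ = proj₁ (proj₂ hook)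
    ρ-strict : Strict P ρ
    ρ-strict = proj₁ (proj₂ (proj₂ hook))

    ρ∈ : ∀ x → ρ x Sub.∈ interval x
    ρ∈ = strict⇒∈-interval ρ-strict

    on-chain : ∀ {x} → toℕ (ρ x) ≢ r → x ≡ chain (ρ x)
    on-chain {x} ≢r = proj₂ (proj₂ (proj₂ hook)) x (chain (ρ x)) (sym (strict-chain ρ-strict (ρ x))) ≢r

    interval-chain : ∀ {i j} → i Sub.∈ interval (chain j) → i ≡ j
    interval-chain {i} {j} i∈ with Fin.<-cmp i j | ∈-interval⁻ i∈
    ... | tri< lt _ _ | ≮ , _ = contradiction (chain-mono lt) ≮
    ... | tri≈ _ eq _ | _     = eq
    ... | tri> _ _ gt | _ , ≯ = contradiction (chain-mono gt) ≯

  Before : Subset ℓ → Subset ℓ → Set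
  Before I J = ∀ {i j} → i Sub.∈ I → j Sub.∈ J → i Fin.< j

  -- As `ρ` is strict, `x` and `y` cannot both lie in its `r`-th fibre, so one of them is on the
  -- chain and its interval is a single index. If the intervals were not in order, the other element
  -- would be comparable to a chain member of its own interval. This is where the hook map is
  -- essential.
  <ₚ⇒Before : ∀ {x y} → x <P y → Before (interval x) (interval y)
  <ₚ⇒Before {x} {y} x<y {i} {j} i∈ j∈ with toℕ (ρ x) ≟ r | i Fin.<? j
  ... | _     | yes i<j = i<j
  ... | no ≢r | no i≮j  = contradiction
    (≤ₚ-<ₚ-trans P (subst (chain j ≤P_) (sym x≡) (chain-≤ longest (subst (j Fin.≤_) i≡ (ℕ.≮⇒≥ i≮j)))) x<y)
    (proj₁ (∈-interval⁻ j∈))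
    where
    x≡ = on-chain ≢r
    i≡ = interval-chain (subst (λ z → i Sub.∈ interval z) x≡ i∈)
  ... | yes ≡r | no i≮j = contradiction
    (<ₚ-≤ₚ-trans P x<y (subst (_≤P chain i) (sym y≡) (chain-≤ longest (subst (Fin._≤ i) j≡ (ℕ.≮⇒≥ i≮j)))))
    (proj₂ (∈-interval⁻ i∈))
    where
    y≡ = on-chain (λ eq → ℕ.<-irrefl (trans ≡r (sym eq)) (ρ-strict x<y))
    j≡ = interval-chain (subst (λ z → j Sub.∈ interval z) y≡ j∈)

  -- Two elements of the `r`-th fibre share the index `r`, so their intervals are not in order.
  -- Otherwise one of the two is a chain element; if `x` were not below `y`, its index would belong
  -- to both intervals, as the opposite order is excluded by `ρ`.
  Before⇒<ₚ : ∀ {x y} → Before (interval x) (interval y) → x <P y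
  Before⇒<ₚ {x} {y} before with toℕ (ρ x) ≟ r | toℕ (ρ y) ≟ r | _<ₚ?_ P x y
  ... | _      | _      | yes x<y = x<y
  ... | yes ≡r | yes ≡r′ | no _   = contradiction (before (ρ∈ x) (ρ∈ y)) (ℕ.<-irrefl (trans ≡r (sym ≡r′)))
  ... | no ≢r  | _      | no x≮y  = contradiction (before (ρ∈ x) (∈-interval⁺
      ( (λ lt → x≮y (subst (_<P y) (sym x≡) lt))
      , (λ lt → ℕ.<-asym (before (ρ∈ x) (ρ∈ y)) (subst (ρ y Fin.<_) (strict-chain ρ-strict _) (ρ-strict lt))))))
    (Fin.<-irrefl refl)
    where x≡ = on-chain ≢r
  ... | _      | no ≢r  | no x≮y  = contradiction (before (∈-interval⁺
      ( (λ lt → ℕ.<-asym (before (ρ∈ x) (ρ∈ y)) (subst (Fin._< ρ x) (strict-chain ρ-strict _) (ρ-strict lt)))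
      , (λ lt → x≮y (subst (x <P_) (sym y≡) lt)))) (ρ∈ y))
    (Fin.<-irrefl refl)
    where y≡ = on-chain ≢r

  ∈-interval⇒strict : ∀ {σ} → (∀ x → σ x Sub.∈ interval x) → Strict P σ
  ∈-interval⇒strict σ∈ {x} {y} x<y = <ₚ⇒Before x<y (σ∈ x) (σ∈ y)

  -- Pushing as many elements as possible out of the levels in J leaves exactly those whose interval lies in J.
  avoiding : ∀ J → ∃[ σ ] (Strict P {ℓ} σ × ∀ {x} → σ x Sub.∈ J → interval x ⊆ J)
  avoiding J = proj₁ ∘ choice , ∈-interval⇒strict (proj₁ ∘ proj₂ ∘ choice) , (λ {x} → proj₂ (proj₂ (choice x)))
    where
    choice : ∀ x → ∃[ i ] (i Sub.∈ interval x × (i Sub.∈ J → interval x ⊆ J))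
    choice x with Fin.any? (λ i → (i Sub.∈? interval x) ×-dec ¬? (i Sub.∈? J))
    ... | yes (i , i∈ , i∉J) = i , i∈ , (λ i∈J → contradiction i∈J i∉J)
    -- The interval has no index outside `J`; `level x` is used only as a member of it.
    ... | no none = level x , strict⇒∈-interval level-strict x , λ _ {i} i∈ → inside-J i i∈
      where
      inside-J : ∀ i → i Sub.∈ interval x → i Sub.∈ J
      inside-J i i∈ with i Sub.∈? J
      ... | yes i∈J = i∈J
      ... | no i∉J  = contradiction (i , i∈ , i∉J) none

-- Chain length, hook maps and interval counts under transfer

module _ {n} {P Q : NatLabeledPoset n} (same : SameDescents P Q) where

  -- The levels of `P`, transferred to `Q`, are injective on the chain of `Q`.
  longest-≤ : ∀ {ℓ ℓ′} → LongestChain P ℓ → LongestChain Q ℓ′ → ℓ′ ≤ ℓ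
  longest-≤ p q with transfer {P = P} {Q} same (LongestChain.level-strict p)
  ... | σ , _ , strict , _ = Fin.injective⇒≤ (strictlyMonotone⇒injective (σ ∘ LongestChain.chain q)
    (λ i<j → strict (LongestChain.chain-mono q i<j)))

  -- Which fibres are singletons is visible from their sizes, and `π` carries fibres to fibres. So
  -- `Q` receives a hook map with no assumption on its shape.
  transfer-hook : ∀ {ℓ} → HookMap P ℓ → HookMap Q ℓ
  transfer-hook (r , σ , strict , inj) with transfer {P = P} {Q} same strict
  ... | σ′ , π , strict′ , σ′π≗σ = r , σ′ , strict′ , λ x y eq ≢r →
    ⟨$⟩ʳ-injective (flip π) (inj _ _ (trans (pull x) (trans eq (sym (pull y)))) (λ ≡r → ≢r (trans (cong toℕ (sym (pull x))) ≡r)))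
    where
    pull : ∀ x → σ (π ⟨$⟩ˡ x) ≡ σ′ x
    pull x = trans (sym (σ′π≗σ _)) (cong σ′ (inverseʳ π))

  module _ {ℓ} (p : LongestChain P ℓ) (q : LongestChain Q ℓ) (hp : HookMap P ℓ) (hq : HookMap Q ℓ) where
    private
      module IP = Interval p hp
      module IQ = Interval q hq

    -- The map of `P` that avoids `J` where possible puts on `J` only elements whose interval lies
    -- inside `J`. After transfer, each `y` whose interval lies inside `J` is forced onto `J`, and
    -- `π` maps these back injectively.
    #-interval-≤ : ∀ J → # (λ y → IQ.interval y Sub.⊆? J) ≤ # (λ x → IP.interval x Sub.⊆? J)
    #-interval-≤ J with IP.avoiding J
    ... | σ , strict , avoids with transfer {P = P} {Q} same strict
    ... | σ′ , π , strict′ , σ′π≗σ = #-injection (λ y → IQ.interval y Sub.⊆? J) (λ x → IP.interval x Sub.⊆? J)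
      (π ⟨$⟩ˡ_) (⟨$⟩ʳ-injective (flip π))
      λ {y} I⊆J {i} → avoids (subst (Sub._∈ J) (sym (trans (sym (σ′π≗σ _)) (cong σ′ (inverseʳ π))))
        (I⊆J (IQ.strict⇒∈-interval strict′ y))) {i}

-- Recovering a multiset of sets from the numbers of members below each set

module _ {ℓ : ℕ} where

  below : Subset ℓ → List (Subset ℓ) → ℕ
  below J Xs = length (filter (λ K → K Sub.⊆? J) Xs)

  minimal : ∀ (X : Subset ℓ) Xs → ∃[ M ] (M ∈ X ∷ Xs × ∀ K → K ∈ X ∷ Xs → K ⊆ M → K ≡ M)
  minimal X [] = X , here refl , λ { _ (here refl) _ → refl }
  minimal X (Y ∷ Ys) with minimal Y Ys
  ... | M , M∈ , min with X Sub.⊆? M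
  -- A member inside `X` lies inside `M`, hence equals `M`, which contains `X`.
  ... | yes X⊆M = X , here refl , λ
    { _ (here refl) _   → refl
    ; K (there K∈)  K⊆X → Sub.⊆-antisym K⊆X (subst (X ⊆_) (sym (min K K∈ (Sub.⊆-trans K⊆X X⊆M))) X⊆M) }
  ... | no X⊈M = M , there M∈ , λ
    { _ (here refl) X⊆M → ⊥-elim (X⊈M X⊆M)
    ; K (there K∈)  K⊆M → min K K∈ K⊆M }

  below-witness : ∀ {J Xs Ys K} → below J Xs ≡ below J Ys → K ∈ Xs → K ⊆ J → ∃[ K′ ] (K′ ∈ Ys × K′ ⊆ J)
  below-witness {J} {Xs} {Ys} eq K∈ K⊆J with filter (λ K → K Sub.⊆? J) Xs | ∈.∈-filter⁺ (λ K → K Sub.⊆? J) {xs = Xs} K∈ K⊆J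
  ... | _ ∷ _ | _ with filter (λ K → K Sub.⊆? J) Ys in eq′
  ... | K′ ∷ _ = K′ , ∈.∈-filter⁻ (λ K → K Sub.⊆? J) {xs = Ys} (subst (K′ ∈_) (sym eq′) (here refl))
  below-witness () _ _ | _ ∷ _ | _ | []

  below-↭ : ∀ J {Xs Ys} → Xs ↭ Ys → below J Xs ≡ below J Ys
  below-↭ J p = ↭.↭-length (↭.filter-↭ (λ K → K Sub.⊆? J) p)

  below-cancel : ∀ M J {Xs Ys} → below J (M ∷ Xs) ≡ below J (M ∷ Ys) → below J Xs ≡ below J Ys
  below-cancel M J eq with M Sub.⊆? J
  ... | yes _ = ℕ.suc-injective eq
  ... | no _  = eq

  -- A minimal member of Xs also belongs to Ys, since each list has a member below every member of the other.
  below-determines : ∀ m {Xs Ys} → length Xs ≡ m → (∀ J → below J Xs ≡ below J Ys) → Xs ↭ Ys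
  below-determines _ {[]} {[]}     _ _  = ↭-refl
  below-determines _ {[]} {Y ∷ Ys} _ eq with below-witness {⊤} {Y ∷ Ys} {[]} (sym (eq ⊤)) (here refl) Sub.⊆⊤
  ... | _ , () , _
  below-determines (suc m) {X ∷ Xs} {Ys} len eq with minimal X Xs
  ... | M , M∈ , min with below-witness {M} {X ∷ Xs} {Ys} (eq M) M∈ Sub.⊆-refl
  ... | K , K∈ , K⊆M with below-witness {K} {Ys} {X ∷ Xs} (sym (eq K)) K∈ Sub.⊆-refl
  ... | K′ , K′∈ , K′⊆K with Sub.⊆-antisym K⊆M (subst (_⊆ K) (min K′ K′∈ (Sub.⊆-trans K′⊆K K⊆M)) K′⊆K)
  ... | refl with ∈.∈-∃++ M∈ | ∈.∈-∃++ K∈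
  ... | as , bs , X≡ | cs , ds , Y≡ = ↭-trans X↭ (↭-trans (prep M rest) (↭-sym Y↭))
    where
    X↭ : X ∷ Xs ↭ M ∷ as ++ bs
    X↭ = subst (_↭ M ∷ as ++ bs) (sym X≡) (↭.shift M as bs)
    Y↭ : Ys ↭ M ∷ cs ++ ds
    Y↭ = subst (_↭ M ∷ cs ++ ds) (sym Y≡) (↭.shift M cs ds)
    rest : as ++ bs ↭ cs ++ ds
    rest = below-determines m (ℕ.suc-injective (trans (sym (↭.↭-length X↭)) len))
      (λ J → below-cancel M J {as ++ bs} {cs ++ ds} (trans (sym (below-↭ J X↭)) (trans (eq J) (below-↭ J Y↭))))

-- Matching the intervals of the two posets

module _ {A : Set} {n} (f g : Fin n → A) where

  ↭-tabulate⇒permutation : List.tabulate f ↭ List.tabulate g → Σ (Permutation′ n) λ π → ∀ x → f x ≡ g (π ⟨$⟩ʳ x)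
  ↭-tabulate⇒permutation f↭g = to-f ∘ₚ middle ∘ₚ flip to-g , λ x → begin
      f x
        ≡⟨ List.lookup-tabulate f x ⟨
      List.lookup (List.tabulate f) (to-f ⟨$⟩ʳ x)
        ≡⟨ ↭ₛ.onIndices-lookup (↭⇒↭ₛ f↭g) (to-f ⟨$⟩ʳ x) ⟩
      List.lookup (List.tabulate g) (middle ⟨$⟩ʳ (to-f ⟨$⟩ʳ x))
        ≡⟨ cong (List.lookup (List.tabulate g)) (inverseʳ to-g) ⟨
      List.lookup (List.tabulate g) (to-g ⟨$⟩ʳ (to-g ⟨$⟩ˡ (middle ⟨$⟩ʳ (to-f ⟨$⟩ʳ x))))
        ≡⟨ List.lookup-tabulate g _ ⟩
      g (to-f ∘ₚ middle ∘ₚ flip to-g ⟨$⟩ʳ x) ∎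
    where
    open ≡-Reasoning
    module ↭ₛ = ↭ₛProperties (Eq.setoid A)
    to-f = cast-id (sym (List.length-tabulate f))
    to-g = cast-id (sym (List.length-tabulate g))
    middle = onIndices (↭⇒↭ₛ f↭g)

filter-length-map : {A B : Set} {P : Pred B 0ℓ} (P? : Decidable P) (f : A → B) → ∀ xs →
  length (filter P? (map f xs)) ≡ length (filter (P? ∘ f) xs)
filter-length-map P? f [] = refl
filter-length-map P? f (x ∷ xs) with does (P? (f x))
... | true  = cong suc (filter-length-map P? f xs)
... | false = filter-length-map P? f xs

#-tabulate : ∀ {A : Set} {n} {P : Pred A 0ℓ} (P? : Decidable P) (f : Fin n → A) →
  length (filter P? (List.tabulate f)) ≡ # (P? ∘ f)
#-tabulate {n = n} P? f = trans (cong (length ∘ filter P?) (sym (List.map-tabulate (λ i → i) f))) (filter-length-map P? f (allFin n))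

module _ {n} {P Q : NatLabeledPoset n} (same : SameDescents P Q) (same⁻¹ : SameDescents Q P)
  {ℓ} (p : LongestChain P ℓ) (q : LongestChain Q ℓ) (hp : HookMap P ℓ) (hq : HookMap Q ℓ) where
  private
    module IP = Interval p hp
    module IQ = Interval q hq

  abstract
    interval-matching : Σ (Permutation′ n) λ π → ∀ x → IP.interval x ≡ IQ.interval (π ⟨$⟩ʳ x)
    interval-matching = ↭-tabulate⇒permutation IP.interval IQ.interval
      (below-determines n {List.tabulate IP.interval} {List.tabulate IQ.interval} (List.length-tabulate IP.interval) λ J →
        trans (#-tabulate (λ K → K Sub.⊆? J) IP.interval)
          (trans (ℕ.≤-antisym (#-interval-≤ {P = Q} {P} same⁻¹ q p hq hp J) (#-interval-≤ {P = P} {Q} same p q hp hq J))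
            (sym (#-tabulate (λ K → K Sub.⊆? J) IQ.interval))))

  interval-matching⇒≅ : P ≅ Q
  interval-matching⇒≅ = π , iso
    where
    π : Permutation′ n
    π = proj₁ interval-matching
    I≡ : ∀ x → IP.interval x ≡ IQ.interval (π ⟨$⟩ʳ x)
    I≡ = proj₂ interval-matching
    iso : ∀ x y → _≼_ P x y ≡ _≼_ Q (π ⟨$⟩ʳ x) (π ⟨$⟩ʳ y)
    iso x y with x Fin.≟ y
    ... | yes refl = T-ext (λ _ → ≼-refl Q _) (λ _ → ≼-refl P _)
    ... | no x≢y = T-ext
      (λ x≤y → proj₁ (IQ.Before⇒<ₚ {π ⟨$⟩ʳ x} {π ⟨$⟩ʳ y} (subst₂ IP.Before (I≡ x) (I≡ y) (IP.<ₚ⇒Before (x≤y , x≢y)))))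
      (λ x≤y → proj₁ (IP.Before⇒<ₚ {x} {y} (subst₂ IQ.Before (sym (I≡ x)) (sym (I≡ y))
        (IQ.<ₚ⇒Before (x≤y , x≢y ∘ ⟨$⟩ʳ-injective π)))))

-- From the hook shape to a hook map

∣p∪q∣≤∣p∣+∣q∣ : ∀ {n} (p q : Subset n) → ∣ p ∪ q ∣ ≤ ∣ p ∣ + ∣ q ∣
∣p∪q∣≤∣p∣+∣q∣ [] [] = z≤n
∣p∪q∣≤∣p∣+∣q∣ (outside ∷ p) (outside ∷ q) = ∣p∪q∣≤∣p∣+∣q∣ p q
∣p∪q∣≤∣p∣+∣q∣ (outside ∷ p) (inside  ∷ q) =
  ℕ.≤-trans (s≤s (∣p∪q∣≤∣p∣+∣q∣ p q)) (ℕ.≤-reflexive (sym (ℕ.+-suc ∣ p ∣ ∣ q ∣)))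
∣p∪q∣≤∣p∣+∣q∣ (inside  ∷ p) (outside ∷ q) = s≤s (∣p∪q∣≤∣p∣+∣q∣ p q)
∣p∪q∣≤∣p∣+∣q∣ (inside  ∷ p) (inside  ∷ q) =
  s≤s (ℕ.≤-trans (∣p∪q∣≤∣p∣+∣q∣ p q) (ℕ.+-monoʳ-≤ ∣ p ∣ (ℕ.n≤1+n ∣ q ∣)))

#-∈ : ∀ {n} (p : Subset n) → # (Sub._∈? p) ≡ ∣ p ∣
#-∈ [] = refl
#-∈ {suc n} (s ∷ p) = go s refl
  where
  tail : length (filter (Sub._∈? (s ∷ p)) (List.tabulate {n = n} suc)) ≡ ∣ p ∣
  tail = trans (#-tabulate (Sub._∈? (s ∷ p)) suc) (trans (ℕ.≤-antisym
    (#-mono (λ x → suc x Sub.∈? (s ∷ p)) (Sub._∈? p) Sub.drop-there)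
    (#-mono (Sub._∈? p) (λ x → suc x Sub.∈? (s ∷ p)) Vec.there)) (#-∈ p))
  go : ∀ s′ → s′ ≡ s → # (Sub._∈? (s ∷ p)) ≡ ∣ s ∷ p ∣
  go outside refl = tail
  go inside  refl = cong suc tail

#-all : ∀ {ℓ} → # {ℓ} (λ _ → T? true) ≡ ℓ
#-all {ℓ} = trans (cong length (List.filter-all (λ _ → T? true) {xs = allFin ℓ} (All.tabulate λ _ → tt)))
  (List.length-tabulate {n = ℓ} (λ i → i))

injective⇒≤∣p∣ : ∀ {ℓ n} {p : Subset n} (f : Fin ℓ → Fin n) → Injective _≡_ _≡_ f → (∀ i → f i Sub.∈ p) → ℓ ≤ ∣ p ∣
injective⇒≤∣p∣ {p = p} f inj f∈ = subst₂ _≤_ #-all (#-∈ p)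
  (#-injection (λ _ → T? true) (Sub._∈? p) f inj (λ {i} _ → f∈ i))

∈-unionAll : ∀ {n i} (As : Vec (Subset n) i) j {x} → x Sub.∈ lookup As j → x Sub.∈ unionAll As
∈-unionAll (A ∷ As) zero    x∈ = Sub.x∈p∪q⁺ (inj₁ x∈)
∈-unionAll (A ∷ As) (suc j) x∈ = Sub.x∈p∪q⁺ (inj₂ (∈-unionAll As j x∈))

∣unionAll∣-≤ : ∀ {n i b} (As : Vec (Subset n) i) → (∀ j → ∣ lookup As j ∣ ≤ b) → ∣ unionAll As ∣ ≤ i * b
∣unionAll∣-≤ {n} [] _ = ℕ.≤-reflexive (Sub.∣⊥∣≡0 n)
∣unionAll∣-≤ (A ∷ As) bound = ℕ.≤-trans (∣p∪q∣≤∣p∣+∣q∣ A (unionAll As))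
  (ℕ.+-mono-≤ (bound zero) (∣unionAll∣-≤ As (bound ∘ suc)))

module _ {n} (P : NatLabeledPoset n) {ℓ} (longest : LongestChain P ℓ) where
  open LongestChain longest

  ℓ≤n : ℓ ≤ n
  ℓ≤n = Fin.injective⇒≤ (chain-injective longest)

  -- The size `n - ℓ + 1`, written without subtraction, is the extreme one: an antichain shares at
  -- most one element with the chain.
  LargeAntichain : Set
  LargeAntichain = ∃[ A ] (IsAntichain P A × n < ∣ A ∣ + ℓ)

  module _ (a : ℕ → ℕ) (a-max : ∀ i → IsMaxAntichainUnion P i (a i)) where

    -- The `ℓ` fibres of `level` are antichains, and together they cover the poset.
    n≤aℓ : n ≤ a ℓ
    n≤aℓ = ℕ.≤-trans (subst (_≤ ∣ unionAll levels ∣) (Sub.∣⊤∣≡n n) (Sub.p⊆q⇒∣p∣≤∣q∣ {p = ⊤} {unionAll levels} (λ {x} _ → covered x)))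
      (proj₂ (a-max ℓ) levels antichains)
      where
      levelSet : Fin ℓ → Subset n
      levelSet j = tabulate (λ x → does (level x Fin.≟ j))
      levels : Vec (Subset n) ℓ
      levels = tabulate levelSet
      levelSet⁻ : ∀ {x j} → x Sub.∈ levelSet j → level x ≡ j
      levelSet⁻ {x} {j} x∈ = toWitness {a? = level x Fin.≟ j} (subst T (sym (isYes≗does (level x Fin.≟ j)))
        (subst T (trans (sym (Vec.[]=⇒lookup x∈)) (Vec.lookup∘tabulate _ x)) tt))
      antichains : AllAntichains P levels
      antichains j x y x∈ y∈ x≤y with x Fin.≟ y
      ... | yes x≡y = x≡y
      ... | no x≢y  = contradiction (level-strict (x≤y , x≢y))
        (Fin.<-irrefl (trans (at x∈) (sym (at y∈))))
        where
        at : ∀ {z} → z Sub.∈ lookup levels j → level z ≡ j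
        at {z} z∈ = levelSet⁻ (subst (z Sub.∈_) (Vec.lookup∘tabulate levelSet j) z∈)
      covered : ∀ x → x Sub.∈ unionAll levels
      covered x = ∈-unionAll levels (level x) (subst (x Sub.∈_) (sym (Vec.lookup∘tabulate levelSet (level x)))
        (Vec.lookup⇒[]= x _ (trans (Vec.lookup∘tabulate _ x) (dec-true (level x Fin.≟ level x) refl))))

    antichain-≤ : ∀ A → IsAntichain P A → ∣ A ∣ ≤ a 1
    antichain-≤ A anti = subst (_≤ a 1) (cong ∣_∣ (Sub.∪-identityʳ A)) (proj₂ (a-max 1) (A ∷ []) (λ { zero → anti }))

    a-≤ : ∀ i → a i ≤ i * a 1
    a-≤ i with proj₁ (a-max i)
    ... | As , anti , size = subst (_≤ i * a 1) size (∣unionAll∣-≤ As (λ j → antichain-≤ (lookup As j) (anti j)))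

    maxAntichain : ∃[ A ] (IsAntichain P A × ∣ A ∣ ≡ a 1)
    maxAntichain with proj₁ (a-max 1)
    ... | A ∷ [] , anti , size = A , anti zero , trans (cong ∣_∣ (sym (Sub.∪-identityʳ A))) size

    module _ (hook : shapePart n a 2 ≤ 1) (1<a1 : 1 < a 1) where

      private
        large? : ∀ j → Dec (T (2 ≤ᵇ conjPart a j))
        large? j = T? _

        -- The second part of the shape counts the indices whose conjugate part is at least 2. Index
        -- 1 is one of them since `1 < a 1`, so a jump by 2 at `suc (suc j)` would supply a second.
        a-step : ∀ {j} → suc j < n → a (suc (suc j)) ≤ suc (a (suc j))
        a-step {j} j<n with a (suc (suc j)) ≤? suc (a (suc j))
        ... | yes le = le
        ... | no gt = contradiction (length-≤ _≡_ {xs = 1 ∷ suc (suc j) ∷ []} (((λ ()) ∷ []) ∷ [] ∷ [])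
            (λ { (here refl) → 1 , first , refl ; (there (here refl)) → suc (suc j) , second , refl })
            (λ { _ _ refl refl → refl }))
          (ℕ.<⇒≱ (s≤s hook))
          where
          parts : List ℕ
          parts = map suc (upTo n)
          a0≡0 : a 0 ≡ 0
          a0≡0 = ℕ.n≤0⇒n≡0 (a-≤ 0)
          first : 1 ∈ filter large? parts
          first = ∈.∈-filter⁺ large? (∈.∈-map⁺ suc (∈.∈-upTo⁺ (ℕ.≤-<-trans z≤n j<n)))
            (ℕ.≤⇒≤ᵇ (subst (λ z → 2 ≤ a 1 ∸ z) (sym a0≡0) 1<a1))
          second : suc (suc j) ∈ filter large? parts
          second = ∈.∈-filter⁺ large? (∈.∈-map⁺ suc (∈.∈-upTo⁺ j<n))
            (ℕ.≤⇒≤ᵇ (ℕ.m+n≤o⇒m≤o∸n 2 (ℕ.≰⇒> gt)))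

      a-suc-≤ : ∀ j → j < n → a (suc j) ≤ a 1 + j
      a-suc-≤ zero    _   = ℕ.m≤m+n (a 1) 0
      a-suc-≤ (suc j) j<n = ℕ.≤-trans (a-step j<n)
        (ℕ.≤-trans (s≤s (a-suc-≤ j (ℕ.<-trans (ℕ.n<1+n j) j<n))) (ℕ.≤-reflexive (sym (ℕ.+-suc (a 1) j))))

  -- In the main case `n ≤ a ℓ ≤ a 1 + (ℓ - 1)`, so an antichain of the maximal size `a 1` is large
  -- enough.
  hook⇒largeAntichain : 0 < n → HookShaped P → LargeAntichain
  hook⇒largeAntichain 0<n (a , a-max , hook) with maxAntichain a a-max
  ... | A , anti , size = A , anti , subst (λ s → n < s + ℓ) (sym size) (n<a1+ℓ (a 1) refl ℓ refl)
    where
    n<a1+ℓ : ∀ s → a 1 ≡ s → ∀ ℓ′ → ℓ ≡ ℓ′ → n < s + ℓ′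
    n<a1+ℓ 0 eq ℓ′ refl = contradiction (ℕ.≤-trans (n≤aℓ a a-max) (ℕ.≤-trans (a-≤ a a-max ℓ) (ℕ.≤-reflexive (trans (cong (ℓ *_) eq) (ℕ.*-zeroʳ ℓ)))))
      (ℕ.<⇒≱ 0<n)
    -- With `a 1` equal to 1 the first conjugate part is below 2, so `a-step` does not apply; the
    -- cruder bound `a ℓ ≤ ℓ` is enough here.
    n<a1+ℓ 1 eq ℓ′ refl = s≤s (ℕ.≤-trans (n≤aℓ a a-max) (ℕ.≤-trans (a-≤ a a-max ℓ) (ℕ.≤-reflexive (trans (cong (ℓ *_) eq) (ℕ.*-identityʳ ℓ)))))
    n<a1+ℓ (suc (suc s)) eq zero refl = contradiction (level (Fin.fromℕ< 0<n)) Fin.¬Fin0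
    n<a1+ℓ (suc (suc s)) eq (suc j) refl = subst (λ z → n < z + suc j) eq
      (ℕ.≤-trans (s≤s (ℕ.≤-trans (n≤aℓ a a-max) (a-suc-≤ a a-max hook (subst (1 <_) (sym eq) (s≤s (s≤s z≤n))) j ℓ≤n)))
        (ℕ.≤-reflexive (sym (ℕ.+-suc (a 1) j))))

  -- The complement of `A` has fewer than `ℓ` elements, so the chain cannot avoid `A`; it meets `A`
  -- at a single position `r`. All elements off the chain lie in `A` too, and the map places them on
  -- level `r`.
  largeAntichain⇒hookMap : LargeAntichain → HookMap P ℓ
  largeAntichain⇒hookMap (A , anti , large) with Fin.any? (λ i → chain i Sub.∈? A)
  ... | no none = contradiction (injective⇒≤∣p∣ chain (chain-injective longest) (λ i → Sub.x∉p⇒x∈∁p (λ i∈ → none (i , i∈)))) too-many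
    where
    too-many : ¬ (ℓ ≤ ∣ Sub.∁ A ∣)
    too-many le = ℕ.<⇒≱ large (subst (∣ A ∣ + ℓ ≤_) (trans (cong (∣ A ∣ +_) (Sub.∣∁p∣≡n∸∣p∣ A)) (ℕ.m+[n∸m]≡n (Sub.∣p∣≤n A))) (ℕ.+-monoʳ-≤ ∣ A ∣ le))
  ... | yes (r , r∈) = toℕ r , σ , strict , σ-injective
    where
    chain? : ∀ x → Dec (∃[ i ] chain i ≡ x)
    chain? x = Fin.any? (λ i → chain i Fin.≟ x)

    only-r : ∀ {i} → chain i Sub.∈ A → i ≡ r
    only-r {i} i∈ with Fin.<-cmp i r
    ... | tri< lt _ _ = chain-injective longest (anti _ _ i∈ r∈ (proj₁ (chain-mono lt)))
    ... | tri≈ _ eq _ = eq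
    ... | tri> _ _ gt = sym (chain-injective longest (anti _ _ r∈ i∈ (proj₁ (chain-mono gt))))

    -- Replacing chain r by a missed element would embed the levels into the complement of A.
    off-chain⇒∈A : ∀ {x} → ¬ (∃[ i ] chain i ≡ x) → x Sub.∈ A
    off-chain⇒∈A {x} off with x Sub.∈? A
    ... | yes x∈ = x∈
    ... | no x∉  = contradiction (injective⇒≤∣p∣ f f-injective f∈)
        (λ le → ℕ.<⇒≱ large (subst (∣ A ∣ + ℓ ≤_) (trans (cong (∣ A ∣ +_) (Sub.∣∁p∣≡n∸∣p∣ A)) (ℕ.m+[n∸m]≡n (Sub.∣p∣≤n A))) (ℕ.+-monoʳ-≤ ∣ A ∣ le)))
      where
      f : Fin ℓ → Fin n
      f i with i Fin.≟ r
      ... | yes _ = x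
      ... | no _  = chain i
      f-injective : Injective _≡_ _≡_ f
      f-injective {i} {j} eq with i Fin.≟ r | j Fin.≟ r
      ... | yes refl | yes refl = refl
      ... | yes _    | no _     = contradiction (j , sym eq) off
      ... | no _     | yes _    = contradiction (i , eq) off
      ... | no _     | no _     = chain-injective longest eq
      f∈ : ∀ i → f i Sub.∈ Sub.∁ A
      f∈ i with i Fin.≟ r
      ... | yes _  = Sub.x∉p⇒x∈∁p x∉
      ... | no i≢r = Sub.x∉p⇒x∈∁p (i≢r ∘ only-r)

    σ : Fin n → Fin ℓ
    σ x with chain? x
    ... | yes (i , _) = i
    ... | no _        = r

    compare-chain : ∀ {i j} → _≤ₚ_ P (chain i) (chain j) → i Fin.≤ j
    compare-chain {i} {j} le with i Fin.≤? j
    ... | yes i≤j = i≤j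
    ... | no i≰j  = contradiction (≼-antisym P _ _ (proj₁ (chain-mono (ℕ.≰⇒> i≰j))) le) (proj₂ (chain-mono (ℕ.≰⇒> i≰j)))

    strict : Strict P σ
    strict {x} {y} (x≤y , x≢y) with chain? x | chain? y
    ... | yes (i , refl) | yes (j , refl) = ℕ.≤∧≢⇒< (compare-chain x≤y) (x≢y ∘ cong chain ∘ Fin.toℕ-injective)
    ... | no offx        | no offy        = contradiction (anti x y (off-chain⇒∈A offx) (off-chain⇒∈A offy) x≤y) x≢y
    ... | yes (i , refl) | no offy with i Fin.<? r
    ... | yes i<r = i<r
    -- Otherwise `chain r` would lie below `y`; both are in `A`, so they would coincide and `y`
    -- would be on the chain.
    ... | no i≮r = contradiction (r , anti _ _ r∈ (off-chain⇒∈A offy) (≼-trans P _ _ _ (chain-≤ longest (ℕ.≮⇒≥ i≮r)) x≤y)) offy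
    strict {x} {y} (x≤y , x≢y) | no offx | yes (j , refl) with r Fin.<? j
    ... | yes r<j = r<j
    ... | no r≮j = contradiction (r , sym (anti _ _ (off-chain⇒∈A offx) r∈ (≼-trans P _ _ _ x≤y (chain-≤ longest (ℕ.≮⇒≥ r≮j))))) offx

    σ-injective : ∀ x y → σ x ≡ σ y → toℕ (σ x) ≢ toℕ r → x ≡ y
    σ-injective x y eq ≢r with chain? x | chain? y
    ... | yes (i , refl) | yes (j , refl) = cong chain eq
    ... | no _           | _              = contradiction refl ≢r
    ... | yes (i , refl) | no _           = contradiction (cong toℕ eq) ≢r

-- From equal supports to the isomorphism

module _ {n} {P Q : NatLabeledPoset n} {cP cQ : List ℕ → ℤ} (eP : IsLExpansion P cP) (eQ : IsLExpansion Q cQ) where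

  supp-⊆⇒SameDescents : (∀ α → InSupp n cP α → InSupp n cQ α) → SameDescents P Q
  supp-⊆⇒SameDescents supp w lin = InSupp⇒LinearExtension Q {cQ} eQ (supp _ (LinearExtension⇒InSupp P {cP} eP w lin))

identity-linear : ∀ {n} (P : NatLabeledPoset n) → LinearExtension P (lookup (tabulate (λ i → i)))
identity-linear P i j le = natural P i j (subst₂ (_≤ₚ_ P) (Vec.lookup∘tabulate _ i) (Vec.lookup∘tabulate _ j) le)

-- The identity word is a linear extension of every naturally labeled poset, so the support is
-- nonempty; a composition common to both supports has sum `n` and sum `m`.
supp-size : ∀ {n m} {P : NatLabeledPoset n} {cP cQ : List ℕ → ℤ} → IsLExpansion P cP →
  (∀ α → InSupp n cP α → InSupp m cQ α) → n ≡ m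
supp-size {n} {m} {P} {cP} eP supp = trans (sym (All.lookup (sum-compositions n) (proj₁ member)))
  (All.lookup (sum-compositions m) (proj₁ (supp _ member)))
  where member = LinearExtension⇒InSupp P {cP} eP (tabulate (λ i → i)) (identity-linear P)

same⇒≅ : ∀ {n} (P Q : NatLabeledPoset n) → HookShaped P → SameDescents P Q → SameDescents Q P → P ≅ Q
-- The empty poset is treated apart, since the strict inequality in `LargeAntichain` fails for it.
same⇒≅ {zero}  P Q _    _    _      = id , λ ()
same⇒≅ {suc n} P Q hook same same⁻¹ = compare (longestChain P) (longestChain Q)
  where
  equal-length : ∀ {ℓ ℓ′} → LongestChain P ℓ → LongestChain Q ℓ′ → ℓ ≡ ℓ′ → P ≅ Q
  equal-length {ℓ} p q refl = interval-matching⇒≅ {P = P} {Q} same same⁻¹ p q hookMap (transfer-hook {P = P} {Q} same hookMap)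
    where
    hookMap : HookMap P ℓ
    hookMap = largeAntichain⇒hookMap P p (hook⇒largeAntichain P p (s≤s z≤n) hook)
  compare : ∃ (LongestChain P) → ∃ (LongestChain Q) → P ≅ Q
  compare (_ , p) (_ , q) = equal-length p q
    (ℕ.≤-antisym (longest-≤ {P = Q} {P} same⁻¹ q p) (longest-≤ {P = P} {Q} same p q))

theorem4p6 : ∀ {n m} (P : NatLabeledPoset n) (Q : NatLabeledPoset m) →
    HookShaped P →
    (cP cQ : List ℕ → ℤ) → IsLExpansion P cP → IsLExpansion Q cQ →
    (∀ α → InSupp n cP α ⇔ InSupp m cQ α) →
    P ≅ Q
theorem4p6 {n} {m} P Q hook cP cQ eP eQ supp =
  equal-size Q eQ supp (supp-size {P = P} {cP} {cQ} eP (λ α → Equivalence.to (supp α)))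
  where
  equal-size : ∀ {m} (Q : NatLabeledPoset m) → IsLExpansion Q cQ →
    (∀ α → InSupp n cP α ⇔ InSupp m cQ α) → n ≡ m → P ≅ Q
  equal-size Q eQ supp refl = same⇒≅ P Q hook
    (supp-⊆⇒SameDescents {P = P} {Q} {cP} {cQ} eP eQ (λ α → Equivalence.to (supp α)))
    (supp-⊆⇒SameDescents {P = Q} {P} {cQ} {cP} eQ eP (λ α → Equivalence.from (supp α)))
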